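{- Let $N$ and $v$ be integers with $2\le v\le N+1$. Let $f=\lfloor\frac{N+1}{v}\rfloor$, $d=(f+1)v-N$, and \[\Lambda(N,v)=\Big\lfloor\tfrac{1}{d}\sum_{i=f-d+2}^{f}(f+1-i)\tbinom{N}{i}\Big\rfloor+\sum_{i=0}^{f-d+1}\tbinom{N}{i}.\] Then $\mathrm{LAK}_{(1,1)}(N,v)=\Lambda(N,v)$.
   Context: Binomial coefficients $\binom{N}{i}$ with $i<0$ are $0$ and empty sums are $0$. For an $N\times k$ array $A$ with entries in each column from a $v$-element symbol set $\Sigma$, and a column $\gamma$ and symbol $\sigma$, let $\rho_A(\{(\gamma,\sigma)\})=\{r\in\{1,\dots,N\}:A_{r\gamma}=\sigma\}$. $A$ is a $(1,1)$-locating array, written $(1,1)$-$\mathrm{LA}(N;k,v)$, if $\rho_A(\{(\gamma,\sigma)\})=\rho_A(\{(\gamma',\sigma')\})$ implies $(\gamma,\sigma)=(\gamma',\sigma')$. $\mathrm{LAK}_{(1,1)}(N,v)$ is the largest $k$ for which a $(1,1)$-$\mathrm{LA}(N;k,v)$ exists. -}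

module Defs where

open import Data.Nat using (ℕ; zero; suc; _+_; _*_; _∸_; _/_)
open import Data.Nat.Combinatorics using (_C_)
open import Data.Integer as ℤ using (ℤ; +_; -[1+_])
open import Data.Fin using (Fin; _≟_)
open import Data.Fin.Subset using (Subset)
open import Data.Vec using (tabulate)
open import Data.List using (List; map; upTo)
open import Data.Nat.ListAction using (sum)
open import Data.Product using (_×_; _,_)
open import Relation.Binary.PropositionalEquality using (_≡_)
open import Relation.Nullary.Decidable using (⌊_⌋)

Array : ℕ → ℕ → ℕ → Set
Array N k v = Fin N → Fin k → Fin v

ρ : ∀ {N k v} → Array N k v → Fin k → Fin v → Subset N
ρ A γ σ = tabulate (λ r → ⌊ A r γ ≟ σ ⌋)

Is11LA : ∀ {N k v} → Array N k v → Set
Is11LA {k = k} {v = v} A =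
  (γ γ' : Fin k) (σ σ' : Fin v) → ρ A γ σ ≡ ρ A γ' σ' → (γ ≡ γ') × (σ ≡ σ')

IsLAK11 : ℕ → ℕ → ℕ → Set
IsLAK11 N v K =
  (Data.Product.Σ (Array N K v) Is11LA)
  × ((k : ℕ) (A : Array N k v) → Is11LA A → k Data.Nat.≤ K)

clamp : ℤ → ℕ
clamp (+ n) = n
clamp -[1+ n ] = 0

binomℤ : ℕ → ℤ → ℕ
binomℤ N (+ i) = N C i
binomℤ N -[1+ i ] = 0

-- Σ_{i=a}^{b} g i   (empty, i.e. 0, when b < a)
sumRange : ℤ → ℤ → (ℤ → ℕ) → ℕ
sumRange a b g = sum (map (λ n → g (a ℤ.+ + n)) (upTo (clamp ((b ℤ.+ + 1) ℤ.- a))))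

-- floor division; only used with a positive divisor (d ≥ 1 under the hypotheses)
_div′_ : ℕ → ℕ → ℕ
m div′ zero = 0
m div′ suc n = m / suc n

Λ : ℕ → ℕ → ℕ
Λ N v =
  (sumRange (fz ℤ.- dz ℤ.+ + 2) fz (λ i → clamp (fz ℤ.+ + 1 ℤ.- i) * binomℤ N i)) div′ d
  + sumRange (+ 0) (fz ℤ.- dz ℤ.+ + 1) (binomℤ N)
  where
  f : ℕ
  f = (N + 1) div′ v
  d : ℕ
  d = (f + 1) * v ∸ N
  fz dz : ℤ
  fz = + f
  dz = ℤ.+_ (f + 1) ℤ.* + v ℤ.- + N

{-# OPTIONS --safe #-}
module Submission where

-- The deficits f + 1 - i of the sizes i of the v classes of a column add up to d, so the
-- weights min(d, f + 1 - i) of the classes with i ≤ f add up to at least d. As all classes of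
-- a locating array are distinct sets of rows, k d ≤ T = Σ_{i ≤ f} min(d, f + 1 - i) C(N, i),
-- and Λ = ⌊T / d⌋. Conversely, by Baranyai's argument the only obstruction to an array whose
-- columns have prescribed class sizes is that some size i is used more than C(N, i) times:
-- rows are added one at a time, and each column chooses the class receiving the new row
-- by Hall's theorem, so that classes with equal trace are split in the right proportion.
-- It remains to choose sizes. Each set of size i < f gets a column of total weight d,
-- completed by sets of size f and at least f + 1, and the remaining sets of size f
-- are packed d to a column; if d = v + 1 those columns must also contain sets of size f - 1.

open import Defs
open import Data.Nat
open import Data.Nat.Properties
open import Data.Nat.Combinatorics using (_C_; nCk+nC[k+1]≡[n+1]C[k+1]; k>n⇒nCk≡0)
open import Data.Nat.DivMod
open import Data.Nat.Divisibility using (divides)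
import Data.Nat.ListAction as List
open import Data.Nat.ListAction.Properties using (sum-++)
open import Data.Nat.Tactic.RingSolver using (solve-∀)
open import Data.Integer as ℤ using (ℤ; -[1+_]) renaming (+_ to pos)
import Data.Integer.Properties as ℤP
import Data.Integer.Tactic.RingSolver as ℤS
open import Data.Bool as B using (Bool; true; false; not; _∧_; _∨_; if_then_else_)
open import Data.Fin as F using (Fin; zero; suc; toℕ; fromℕ<; _↑ˡ_; _↑ʳ_; splitAt)
import Data.Fin.Properties as FP
open import Data.Fin.Subset.Properties using (anySubset?)
open import Data.List as L using (List; []; _∷_; _++_; replicate; length; map; applyUpTo)
open import Data.List.Properties using (length-++; length-replicate)
open import Data.List.Relation.Unary.All using (All; []; _∷_)
import Data.List.Relation.Unary.All.Properties as AllP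
open import Data.Vec using (lookup; tabulate)
open import Data.Vec.Properties using (lookup∘tabulate; tabulate-cong)
open import Data.Product using (Σ; ∃-syntax; _×_; _,_; proj₁; proj₂)
open import Data.Sum using (_⊎_; inj₁; inj₂; [_,_]′)
open import Data.Empty using (⊥; ⊥-elim)
open import Function using (_∘_; id)
open import Relation.Nullary using (¬_; Dec; yes; no; does)
open import Relation.Nullary.Decidable using (isYes≗does; ⌊_⌋; _×-dec_; ¬?)
open import Relation.Binary using (Decidable; tri<; tri≈; tri>)
open import Relation.Binary.PropositionalEquality
open import Algebra.Properties.Semiring.Sum +-*-semiring using (sum; ∑-distrib-+; ∑-comm; sum-cong-≗; *-distribˡ-sum; *-distribʳ-sum; sum-replicate-zero)

-- Writing r for the remainder of N + 1 modulo v gives d = v + 1 - r, so 2 ≤ d ≤ v + 1. Making every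
-- column of the construction weigh exactly d confines all rounding to the packing of the last sets
-- of size f, and this yields the floor in Λ. The obstacle is the supply of sets of size f + 1,
-- which fill the columns up. Writing c i for C(N, i), it is overcome by growth: for i < f
-- consecutive layers satisfy c (i + 1) ≥ (v - 1) c i, so the demand of all earlier columns stays
-- below a small multiple of the last layer. For v = 2 this growth is void, and a column consisting
-- of two sets is treated directly. In Baranyai's step the weight given to a class by a column is
-- the number of rows its blocks still need there, out of all rows left. The resulting column sums
-- are multiples of the number of rows left precisely because of the absorption identity, so Hall's
-- theorem rounds the fractional choice without any loss.

𝟙 : ∀ {p} {P : Set p} → Dec P → ℕ
𝟙 (yes _) = 1
𝟙 (no _) = 0

module _ {p} {P : Set p} where

  𝟙-yes : (d : Dec P) → P → 𝟙 d ≡ 1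
  𝟙-yes (yes _) _ = refl
  𝟙-yes (no ¬p) p = ⊥-elim (¬p p)

  𝟙-no : (d : Dec P) → ¬ P → 𝟙 d ≡ 0
  𝟙-no (yes p) ¬p = ⊥-elim (¬p p)
  𝟙-no (no _) _ = refl

  𝟙>0 : (d : Dec P) → 0 < 𝟙 d → P
  𝟙>0 (yes p) _ = p

𝟙≤1 : ∀ {p} {P : Set p} (d : Dec P) → 𝟙 d ≤ 1
𝟙≤1 (yes _) = ≤-refl
𝟙≤1 (no _) = z≤n

module _ {p q} {P : Set p} {Q : Set q} where

  𝟙-mono : (d : Dec P) (e : Dec Q) → (P → Q) → 𝟙 d ≤ 𝟙 e
  𝟙-mono (no _) e f = z≤n
  𝟙-mono (yes p) e f = ≤-reflexive (sym (𝟙-yes e (f p)))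

𝟙-cong : ∀ {p q} {P : Set p} {Q : Set q} (d : Dec P) (e : Dec Q) → (P → Q) → (Q → P) → 𝟙 d ≡ 𝟙 e
𝟙-cong d e f g = ≤-antisym (𝟙-mono d e f) (𝟙-mono e d g)

-- Finite sums of natural numbers.

sum-mono-≤ : ∀ {n} {f g : Fin n → ℕ} → (∀ i → f i ≤ g i) → sum f ≤ sum g
sum-mono-≤ {zero} h = z≤n
sum-mono-≤ {suc n} h = +-mono-≤ (h zero) (sum-mono-≤ (h ∘ suc))

sum-mono-< : ∀ {n} {f g : Fin n → ℕ} → (∀ i → f i ≤ g i) → ∀ k → f k < g k → sum f < sum g
sum-mono-< h zero lt = +-mono-<-≤ lt (sum-mono-≤ (h ∘ suc))
sum-mono-< h (suc k) lt = +-mono-≤-< (h zero) (sum-mono-< (h ∘ suc) k lt)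

sum-zero : ∀ {n} {f : Fin n → ℕ} → (∀ i → f i ≡ 0) → sum f ≡ 0
sum-zero {n} h = trans (sum-cong-≗ h) (sum-replicate-zero n)

sum-const : ∀ n c → sum {n} (λ _ → c) ≡ n * c
sum-const zero c = refl
sum-const (suc n) c = cong (c +_) (sum-const n c)

≤-sum : ∀ {n} (f : Fin n → ℕ) i → f i ≤ sum f
≤-sum f zero = m≤m+n _ _
≤-sum f (suc i) = ≤-trans (≤-sum (f ∘ suc) i) (m≤n+m _ _)

sum>0 : ∀ {n} (f : Fin n → ℕ) → 0 < sum f → ∃[ i ] 0 < f i
sum>0 {suc n} f p with f zero in eq
... | suc x = zero , subst (0 <_) (sym eq) (s≤s z≤n)
... | zero with sum>0 (f ∘ suc) p
...   | i , q = suc i , q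

sum-unique : ∀ {n} (f : Fin n → ℕ) k → (∀ i → i ≢ k → f i ≡ 0) → sum f ≡ f k
sum-unique f zero h = trans (cong (f zero +_) (sum-zero (λ i → h (suc i) λ ()))) (+-identityʳ _)
sum-unique f (suc k) h =
  trans (cong (_+ sum (f ∘ suc)) (h zero λ ())) (sum-unique (f ∘ suc) k (λ i ne → h (suc i) (ne ∘ FP.suc-injective)))

sum-𝟙≟ : ∀ {n} (k : Fin n) → sum (λ i → 𝟙 (i F.≟ k)) ≡ 1
sum-𝟙≟ k = trans (sum-unique _ k (λ i → 𝟙-no (i F.≟ k))) (𝟙-yes (k F.≟ k) refl)

-- Hall's theorem with capacities, and its regular case.

module Hall {K T : ℕ} (a : Fin T → ℕ) where

  size : (Fin K → Bool) → ℕ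
  size S = sum λ j → 𝟙 (S j B.≟ true)

  module _ {E : Fin K → Fin T → Set} (E? : Decidable E) where

    Nbr : (Fin K → Bool) → Fin T → Set
    Nbr S t = ∃[ j ] (S j ≡ true × E j t)

    nbr? : ∀ S t → Dec (Nbr S t)
    nbr? S t = FP.any? λ j → (S j B.≟ true) ×-dec E? j t

    cap : (Fin K → Bool) → ℕ
    cap S = sum λ t → a t * 𝟙 (nbr? S t)

    HallCondition : Set
    HallCondition = ∀ S → size S ≤ cap S

    edges : ℕ
    edges = sum λ j → sum λ t → 𝟙 (E? j t)

    -- The search runs over vectors; a function `S` agrees with `lookup (tabulate S)` only
    -- pointwise, so both sides of the inequality are carried across by monotonicity.
    hall? : HallCondition ⊎ ∃[ S ] cap S < size S
    hall? with anySubset? (λ S → cap (lookup S) <? size (lookup S))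
    ... | yes (S , lt) = inj₂ (lookup S , lt)
    ... | no none = inj₁ λ S → let S≗ = lookup∘tabulate S in begin
      size S                     ≤⟨ sum-mono-≤ (λ j → 𝟙-mono (S j B.≟ true) (_ B.≟ true) (trans (S≗ j))) ⟩
      size (lookup (tabulate S)) ≤⟨ ≮⇒≥ (λ lt → none (tabulate S , lt)) ⟩
      cap (lookup (tabulate S))  ≤⟨ sum-mono-≤ (λ t → *-monoʳ-≤ (a t) (𝟙-mono (nbr? (lookup (tabulate S)) t) (nbr? S t)
                                      λ (j , Sj , e) → j , trans (sym (S≗ j)) Sj , e)) ⟩
      cap S                      ∎
      where open ≤-Reasoning

  Without : (Fin K → Fin T → Set) → Fin K → Fin T → Fin K → Fin T → Set
  Without E j t i u = E i u × ¬ (i ≡ j × u ≡ t)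

  without? : ∀ {E} → Decidable E → ∀ j t → Decidable (Without E j t)
  without? E? j t i u = E? i u ×-dec ¬? ((i F.≟ j) ×-dec (u F.≟ t))

  edges-without : ∀ {E} (E? : Decidable E) j t → E j t → edges (without? E? j t) < edges E?
  edges-without E? j t e =
    sum-mono-< (λ i → sum-mono-≤ (le i)) j
      (sum-mono-< (le j) t
        (subst₂ _<_ (sym (𝟙-no (without? E? j t j t) (λ (_ , n) → n (refl , refl)))) (sym (𝟙-yes (E? j t) e)) (s≤s z≤n)))
    where
    le : ∀ i u → 𝟙 (without? E? j t i u) ≤ 𝟙 (E? i u)
    le i u = 𝟙-mono (without? E? j t i u) (E? i u) proj₁

  -- Rado: if both deletions broke the condition, submodularity of the capacity of the
  -- neighbourhood would break it already for S₁ ∪ S₂ or for (S₁ ∩ S₂) ∖ {j}.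
  module _ {E : Fin K → Fin T → Set} (E? : Decidable E) (hall : HallCondition E?) {j : Fin K} {t₁ t₂ : Fin T} (t₁≢t₂ : t₁ ≢ t₂) where

    private
      E₁? = without? E? j t₁
      E₂? = without? E? j t₂

    -- A set avoiding `j` keeps all its edges when one at `j` is deleted, so it still satisfies
    -- Hall's condition.
    must-contain : ∀ t S → cap (without? E? j t) S < size S → S j ≡ true
    must-contain t S lt with S j B.≟ true
    ... | yes p = p
    ... | no ¬p = ⊥-elim (<-irrefl refl (<-≤-trans lt (≤-trans (hall S)
      (sum-mono-≤ λ u → *-monoʳ-≤ (a u) (𝟙-mono (nbr? E? S u) (nbr? (without? E? j t) S u)
        λ (i , Si , e) → i , Si , e , λ (i≡j , _) → ¬p (subst (λ x → S x ≡ true) i≡j Si))))))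

    one-deletion-works : ∀ S₁ S₂ → cap E₁? S₁ < size S₁ → cap E₂? S₂ < size S₂ → ⊥
    one-deletion-works S₁ S₂ lt₁ lt₂ = <-irrefl refl (begin-strict
      size S₁ + size S₂                ≡⟨ sizes ⟩
      suc (size U + size I)            ≤⟨ s≤s (+-mono-≤ (hall U) (hall I)) ⟩
      suc (cap E? U + cap E? I)        ≤⟨ s≤s caps ⟩
      suc (cap E₁? S₁ + cap E₂? S₂)    <⟨ s≤s (≤-reflexive (sym (+-suc _ _))) ⟩
      suc (cap E₁? S₁) + suc (cap E₂? S₂) ≤⟨ +-mono-≤ lt₁ lt₂ ⟩
      size S₁ + size S₂                ∎)
      where
      open ≤-Reasoning
      S₁j = must-contain t₁ S₁ lt₁
      S₂j = must-contain t₂ S₂ lt₂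
      U I : Fin K → Bool
      U i = S₁ i ∨ S₂ i
      -- Leaving out `j` ensures that neither deletion touches an edge at `I`. It costs one element,
      -- while the two strict inequalities together provide two.
      I i = (S₁ i ∧ S₂ i) ∧ not (does (i F.≟ j))

      sizes-at : ∀ i → 𝟙 (S₁ i B.≟ true) + 𝟙 (S₂ i B.≟ true)
                     ≡ (𝟙 (U i B.≟ true) + 𝟙 (I i B.≟ true)) + 𝟙 (i F.≟ j)
      sizes-at i with i F.≟ j
      ... | yes refl rewrite S₁j | S₂j = refl
      ... | no _ with S₁ i | S₂ i
      ...   | true  | true  = refl
      ...   | true  | false = refl
      ...   | false | true  = refl
      ...   | false | false = refl

      sizes : size S₁ + size S₂ ≡ suc (size U + size I)
      sizes = begin-equality
        size S₁ + size S₂ ≡⟨ ∑-distrib-+ (λ i → 𝟙 (S₁ i B.≟ true)) _ ⟨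
        _                 ≡⟨ sum-cong-≗ sizes-at ⟩
        _                 ≡⟨ ∑-distrib-+ (λ i → 𝟙 (U i B.≟ true) + 𝟙 (I i B.≟ true)) _ ⟩
        _                 ≡⟨ cong₂ _+_ (∑-distrib-+ (λ i → 𝟙 (U i B.≟ true)) _) (sum-𝟙≟ j) ⟩
        size U + size I + 1 ≡⟨ +-comm _ 1 ⟩
        suc (size U + size I) ∎

      -- The edge from `j` to `t₁` is missing only from the first graph; as `j` also lies in `S₂`
      -- and `t₁ ≢ t₂`, it is still counted in the second.
      U⇒ : ∀ u → Nbr E? U u → Nbr E₁? S₁ u ⊎ Nbr E₂? S₂ u
      U⇒ u (i , Ui , e) with i F.≟ j
      U⇒ u (i , Ui , e) | yes refl with u F.≟ t₁
      ... | yes refl = inj₂ (i , S₂j , e , λ (_ , p) → t₁≢t₂ p)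
      ... | no u≢t₁ = inj₁ (i , S₁j , e , λ (_ , p) → u≢t₁ p)
      U⇒ u (i , Ui , e) | no i≢j with S₁ i in eq
      ... | true = inj₁ (i , eq , e , λ (p , _) → i≢j p)
      ... | false = inj₂ (i , Ui , e , λ (p , _) → i≢j p)

      I⇒ : ∀ u → Nbr E? I u → Nbr E₁? S₁ u × Nbr E₂? S₂ u
      I⇒ u (i , Ii , e) with i F.≟ j | S₁ i in eq₁ | S₂ i in eq₂
      ... | no i≢j | true | true = (i , eq₁ , e , λ (p , _) → i≢j p) , (i , eq₂ , e , λ (p , _) → i≢j p)

      modular : ∀ {P Q R S : Set} (p : Dec P) (q : Dec Q) (r : Dec R) (s : Dec S) →
                (R → P ⊎ Q) → (S → P × Q) → 𝟙 r + 𝟙 s ≤ 𝟙 p + 𝟙 q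
      modular p q r (yes s) f g =
        ≤-trans (+-monoˡ-≤ 1 (𝟙-mono r p (λ _ → proj₁ (g s)))) (+-monoʳ-≤ (𝟙 p) (≤-reflexive (sym (𝟙-yes q (proj₂ (g s))))))
      modular p q (no _) (no _) f g = z≤n
      modular p q (yes r) (no _) f g with f r
      ... | inj₁ x = ≤-trans (≤-reflexive (sym (𝟙-yes p x))) (m≤m+n _ _)
      ... | inj₂ x = ≤-trans (≤-reflexive (sym (𝟙-yes q x))) (m≤n+m _ _)

      caps : cap E? U + cap E? I ≤ cap E₁? S₁ + cap E₂? S₂
      caps = begin
        _ ≡⟨ ∑-distrib-+ (λ u → a u * 𝟙 (nbr? E? U u)) _ ⟨
        _ ≤⟨ sum-mono-≤ (λ u → subst₂ _≤_ (*-distribˡ-+ (a u) _ _) (*-distribˡ-+ (a u) _ _)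
               (*-monoʳ-≤ (a u) (modular (nbr? E₁? S₁ u) (nbr? E₂? S₂ u) (nbr? E? U u) (nbr? E? I u) (U⇒ u) (I⇒ u)))) ⟩
        _ ≡⟨ ∑-distrib-+ (λ u → a u * 𝟙 (nbr? E₁? S₁ u)) _ ⟩
        _ ∎

  record Assignment (E : Fin K → Fin T → Set) : Set where
    field
      to    : Fin K → Fin T
      edge  : ∀ j → E j (to j)
      bound : ∀ t → sum (λ j → 𝟙 (to j F.≟ t)) ≤ a t

  module _ {E : Fin K → Fin T → Set} (E? : Decidable E) (hall : HallCondition E?) where

    -- Hall's condition for a singleton.
    some-edge : ∀ j → ∃[ t ] E j t
    some-edge j = t , subst (λ i → E i t) (is-j i Si) e
      where
      S : Fin K → Bool
      S i = does (i F.≟ j)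
      is-j : ∀ i → S i ≡ true → i ≡ j
      is-j i Si with i F.≟ j
      ... | yes p = p
      Sj : S j ≡ true
      Sj with j F.≟ j
      ... | yes _ = refl
      ... | no ¬p = ⊥-elim (¬p refl)
      witness = sum>0 (λ t → a t * 𝟙 (nbr? E? S t)) (≤-trans
        (≤-trans (≤-reflexive (sym (𝟙-yes (S j B.≟ true) Sj))) (≤-sum (λ i → 𝟙 (S i B.≟ true)) j)) (hall S))
      t = proj₁ witness
      t∈N : Nbr E? S t
      t∈N = 𝟙>0 (nbr? E? S t) (n≢0⇒n>0 λ z →
        <-irrefl (sym (trans (cong (a t *_) z) (*-zeroʳ (a t)))) (proj₂ witness))
      i = proj₁ t∈N
      Si = proj₁ (proj₂ t∈N)
      e = proj₂ (proj₂ t∈N)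

    -- With one neighbour per `j`, the fibre over `t` has `t` as its only neighbour, so Hall's
    -- condition for the fibre is the capacity bound.
    functional⇒assignment : (∀ j t t′ → E j t → E j t′ → t ≡ t′) → Assignment E
    functional⇒assignment unique = record { to = to ; edge = λ j → proj₂ (some-edge j) ; bound = bound }
      where
      to : Fin K → Fin T
      to j = proj₁ (some-edge j)
      module _ (t : Fin T) where
        S : Fin K → Bool
        S j = does (to j F.≟ t)
        to-t : ∀ j → S j ≡ true → to j ≡ t
        to-t j Sj with to j F.≟ t
        ... | yes p = p
        S-t : ∀ j → to j ≡ t → S j ≡ true
        S-t j p with to j F.≟ t
        ... | yes _ = refl
        ... | no ¬p = ⊥-elim (¬p p)
        only-t : ∀ u → u ≢ t → ¬ Nbr E? S u
        only-t u u≢t (j , Sj , e) = u≢t (trans (unique j u (to j) e (proj₂ (some-edge j))) (to-t j Sj))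
        bound : sum (λ j → 𝟙 (to j F.≟ t)) ≤ a t
        bound = begin
          sum (λ j → 𝟙 (to j F.≟ t)) ≤⟨ sum-mono-≤ (λ j → 𝟙-mono (to j F.≟ t) (S j B.≟ true) (S-t j)) ⟩
          size S                     ≤⟨ hall S ⟩
          cap E? S                   ≡⟨ sum-unique _ t (λ u u≢t → trans (cong (a u *_) (𝟙-no (nbr? E? S u) (only-t u u≢t))) (*-zeroʳ (a u))) ⟩
          a t * 𝟙 (nbr? E? S t)      ≤⟨ *-monoʳ-≤ (a t) (𝟙≤1 (nbr? E? S t)) ⟩
          a t * 1                    ≡⟨ *-identityʳ (a t) ⟩
          a t                        ∎
          where open ≤-Reasoning

  weaken : ∀ {E E′ : Fin K → Fin T → Set} → (∀ {j t} → E′ j t → E j t) → Assignment E′ → Assignment E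
  weaken sub α = record { to = to ; edge = sub ∘ edge ; bound = bound }
    where open Assignment α

  -- Recursion on a bound `n` for the number of edges, which every deletion lowers.
  rado : ∀ n {E} (E? : Decidable E) → edges E? < n → HallCondition E? → Assignment E
  rado (suc n) E? (s≤s e≤n) hall
    with FP.any? (λ j → FP.any? λ t → FP.any? λ t′ → E? j t ×-dec E? j t′ ×-dec ¬? (t F.≟ t′))
  ... | no none = functional⇒assignment E? hall unique
    where
    unique : ∀ j t t′ → _ → _ → t ≡ t′
    unique j t t′ e e′ with t F.≟ t′
    ... | yes p = p
    ... | no ¬p = ⊥-elim (none (j , t , t′ , e , e′ , ¬p))
  ... | yes (j , t , t′ , e , e′ , t≢t′) with hall? (without? E? j t) | hall? (without? E? j t′)
  ...   | inj₁ hall₁ | _ = weaken proj₁ (rado n (without? E? j t) (<-≤-trans (edges-without E? j t e) e≤n) hall₁)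
  ...   | inj₂ _ | inj₁ hall₂ = weaken proj₁ (rado n (without? E? j t′) (<-≤-trans (edges-without E? j t′ e′) e≤n) hall₂)
  ...   | inj₂ (S₁ , lt₁) | inj₂ (S₂ , lt₂) = ⊥-elim (one-deletion-works E? hall t≢t′ S₁ S₂ lt₁ lt₂)

  hall-theorem : ∀ {E} (E? : Decidable E) → HallCondition E? → Assignment E
  hall-theorem E? = rado _ E? ≤-refl

abstract
  -- Divided by `m`, the matrix `w` is a fractional assignment that exhausts every capacity.
  -- Counting the weight leaving `S` at both ends gives Hall's condition, and since the capacities
  -- add up to `K`, no capacity bound can be slack.
  regular-assignment : ∀ {K T} (w : Fin K → Fin T → ℕ) (a : Fin T → ℕ) m → 0 < m →
    (∀ j → sum (w j) ≡ m) → (∀ t → sum (λ j → w j t) ≡ m * a t) →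
    Σ (Fin K → Fin T) λ g → ((∀ j → 0 < w j (g j)) × (∀ t → sum (λ j → 𝟙 (g j F.≟ t)) ≡ a t))
  regular-assignment {K} {T} w a m m>0 row col = to , edge , λ t → ≤-antisym (bound t) (tight t)
    where
    open Hall a
    open ≤-Reasoning
    E? : Decidable (λ j t → 0 < w j t)
    E? j t = 0 <? w j t

    hall : HallCondition E?
    hall S = *-cancelˡ-≤ m {{>-nonZero m>0}} (begin
      m * size S ≡⟨ *-distribˡ-sum m (λ j → 𝟙 (S j B.≟ true)) ⟩
      sum (λ j → m * 𝟙 (S j B.≟ true)) ≡⟨ sum-cong-≗ (λ j → trans (cong (_* 𝟙 (S j B.≟ true)) (sym (row j))) (*-distribʳ-sum (𝟙 (S j B.≟ true)) (w j))) ⟩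
      sum (λ j → sum (λ t → w j t * 𝟙 (S j B.≟ true))) ≤⟨ sum-mono-≤ (λ j → sum-mono-≤ (λ t → le j t)) ⟩
      sum (λ j → sum (λ t → w j t * 𝟙 (nbr? E? S t))) ≡⟨ ∑-comm (λ j t → w j t * 𝟙 (nbr? E? S t)) ⟩
      sum (λ t → sum (λ j → w j t * 𝟙 (nbr? E? S t))) ≡⟨ sum-cong-≗ (λ t → trans (sym (*-distribʳ-sum (𝟙 (nbr? E? S t)) (λ j → w j t)))
                                                          (trans (cong (_* 𝟙 (nbr? E? S t)) (col t)) (*-assoc m (a t) _))) ⟩
      sum (λ t → m * (a t * 𝟙 (nbr? E? S t))) ≡⟨ *-distribˡ-sum m (λ t → a t * 𝟙 (nbr? E? S t)) ⟨
      m * cap E? S ∎)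
      where
      le : ∀ j t → w j t * 𝟙 (S j B.≟ true) ≤ w j t * 𝟙 (nbr? E? S t)
      le j t with w j t in eq
      ... | zero = z≤n
      ... | suc x = *-monoʳ-≤ (suc x) (𝟙-mono (S j B.≟ true) (nbr? E? S t) λ Sj → j , Sj , subst (0 <_) (sym eq) (s≤s z≤n))

    open Assignment (hall-theorem E? hall)

    total : sum a ≤ sum (λ t → sum (λ j → 𝟙 (to j F.≟ t)))
    total = *-cancelˡ-≤ m {{>-nonZero m>0}} (begin
      m * sum a ≡⟨ *-distribˡ-sum m a ⟩
      sum (λ t → m * a t) ≡⟨ sum-cong-≗ (λ t → col t) ⟨
      sum (λ t → sum (λ j → w j t)) ≡⟨ ∑-comm w ⟨
      sum (λ j → sum (w j)) ≡⟨ sum-cong-≗ row ⟩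
      sum {K} (λ j → m) ≡⟨ trans (sum-const K m) (*-comm K m) ⟩
      m * K ≡⟨ cong (m *_) (trans (sym (*-identityʳ K)) (sym (sum-const K 1))) ⟩
      m * sum {K} (λ j → 1) ≡⟨ cong (m *_) (sum-cong-≗ (λ j → trans (sum-cong-≗ (λ t → 𝟙-cong (to j F.≟ t) (t F.≟ to j) sym sym)) (sum-𝟙≟ (to j)))) ⟨
      m * sum (λ j → sum (λ t → 𝟙 (to j F.≟ t))) ≡⟨ cong (m *_) (∑-comm (λ j t → 𝟙 (to j F.≟ t))) ⟩
      m * sum (λ t → sum (λ j → 𝟙 (to j F.≟ t))) ∎)

    tight : ∀ t → a t ≤ sum (λ j → 𝟙 (to j F.≟ t))
    tight t = ≮⇒≥ λ lt → <-irrefl refl (<-≤-trans (sum-mono-< bound t lt) total)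

-- Identities for binomial coefficients.

pascal : ∀ n k → suc n C suc k ≡ n C k + n C suc k
pascal n k = sym (nCk+nC[k+1]≡[n+1]C[k+1] n k)

-- Of the blocks that share a trace and need `suc r` of the `suc m` remaining rows, this determines
-- how many receive the next row: `m C r`.
absorption : ∀ m r → suc r * (suc m C suc r) ≡ suc m * (m C r)
absorption zero zero = refl
absorption zero (suc r) = begin
  suc (suc r) * (1 C suc (suc r)) ≡⟨ cong (suc (suc r) *_) (k>n⇒nCk≡0 {1} {suc (suc r)} (s≤s (s≤s z≤n))) ⟩
  suc (suc r) * 0                 ≡⟨ *-zeroʳ r ⟩
  0                               ≡⟨ cong (1 *_) (k>n⇒nCk≡0 {0} {suc r} (s≤s z≤n)) ⟨
  1 * (0 C suc r)                 ∎
  where open ≡-Reasoning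
absorption (suc m) zero = begin
  1 * (suc (suc m) C 1)        ≡⟨ cong (1 *_) (pascal (suc m) 0) ⟩
  1 * (1 + suc m C 1)          ≡⟨ lem (suc m C 1) ⟩
  1 + 1 * (suc m C 1)          ≡⟨ cong (1 +_) (absorption m 0) ⟩
  1 + suc m * 1                ≡⟨⟩
  suc (suc m) * 1              ∎
  where
  open ≡-Reasoning
  lem : ∀ x → 1 * (1 + x) ≡ 1 + 1 * x
  lem = solve-∀
absorption (suc m) (suc r) = begin
  suc (suc r) * (suc (suc m) C suc (suc r)) ≡⟨ cong (suc (suc r) *_) (pascal (suc m) (suc r)) ⟩
  suc (suc r) * (x + y)                     ≡⟨ split (suc r) x y ⟩
  x + (suc r * x + suc (suc r) * y)         ≡⟨ cong₂ (λ p q → x + (p + q)) (absorption m r) (absorption m (suc r)) ⟩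
  x + (suc m * (m C r) + suc m * (m C suc r)) ≡⟨ cong (x +_) (*-distribˡ-+ (suc m) (m C r) _) ⟨
  x + suc m * (m C r + m C suc r)           ≡⟨ cong (λ z → x + suc m * z) (pascal m r) ⟨
  suc (suc m) * x                           ∎
  where
  open ≡-Reasoning
  x = suc m C suc r
  y = suc m C suc (suc r)
  split : ∀ r x y → suc r * (x + y) ≡ x + (r * x + suc r * y)
  split = solve-∀

-- Baranyai's argument: building the array row by row.

two-≤-sum : ∀ {n} (f : Fin n → ℕ) {i k} → i ≢ k → f i + f k ≤ sum f
two-≤-sum f {zero} {zero} i≢k = ⊥-elim (i≢k refl)
two-≤-sum f {zero} {suc k} _ = +-monoʳ-≤ (f zero) (≤-sum (f ∘ suc) k)
two-≤-sum f {suc i} {zero} _ = subst (_≤ sum f) (+-comm (f zero) _) (+-monoʳ-≤ (f zero) (≤-sum (f ∘ suc) i))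
two-≤-sum f {suc i} {suc k} i≢k = ≤-trans (two-≤-sum (f ∘ suc) (i≢k ∘ cong suc)) (m≤n+m _ _)

sum≤1⇒unique : ∀ {n} (f : Fin n → ℕ) → sum f ≤ 1 → ∀ {i k} → 0 < f i → 0 < f k → i ≡ k
sum≤1⇒unique f le {i} {k} p q with i F.≟ k
... | yes e = e
... | no i≢k = ⊥-elim (<-irrefl refl (≤-trans (+-mono-≤ p q) (≤-trans (two-≤-sum f i≢k) le)))

sum₂ : ∀ {K V} → (Fin K → Fin V → ℕ) → ℕ
sum₂ f = sum λ j → sum (f j)

sum₂≤1⇒unique : ∀ {K V} (f : Fin K → Fin V → ℕ) → sum₂ f ≤ 1 →
  ∀ {j j′ b b′} → 0 < f j b → 0 < f j′ b′ → j ≡ j′ × b ≡ b′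
sum₂≤1⇒unique f le {j} p q
  with refl ← sum≤1⇒unique (sum ∘ f) le (<-≤-trans p (≤-sum (f _) _)) (<-≤-trans q (≤-sum (f _) _))
  = refl , sum≤1⇒unique (f j) (≤-trans (≤-sum (sum ∘ f) j) le) p q

sum₂-+ : ∀ {K V} (f g : Fin K → Fin V → ℕ) → sum₂ (λ j b → f j b + g j b) ≡ sum₂ f + sum₂ g
sum₂-+ f g = trans (sum-cong-≗ λ j → ∑-distrib-+ (f j) (g j)) (∑-distrib-+ (sum ∘ f) (sum ∘ g))

-- The left copy of the classes is for blocks that receive the new row, the right copy for those
-- that miss it. The unconstrained class is not split.
refine : ∀ {P} → Fin (suc P) → Bool → Fin (suc (P + P))
refine zero _ = zero
refine {P} (suc c) true = suc (c ↑ˡ P)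
refine {P} (suc c) false = suc (P ↑ʳ c)

refine-injective : ∀ {P} (t : Fin (suc P)) c β γ → refine t β ≡ refine (suc c) γ → t ≡ suc c × β ≡ γ
refine-injective {P} (suc c′) c true true e = cong suc (FP.↑ˡ-injective P c′ c (FP.suc-injective e)) , refl
refine-injective {P} (suc c′) c false false e = cong suc (FP.↑ʳ-injective P c′ c (FP.suc-injective e)) , refl
refine-injective {P} (suc c′) c true false e
  with () ← trans (sym (FP.splitAt-↑ˡ P c′ P)) (trans (cong (splitAt P) (FP.suc-injective e)) (FP.splitAt-↑ʳ P P c))
refine-injective {P} (suc c′) c false true e
  with () ← trans (sym (FP.splitAt-↑ʳ P P c′)) (trans (cong (splitAt P) (FP.suc-injective e)) (FP.splitAt-↑ˡ P c P))
refine-injective zero c _ true ()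
refine-injective zero c _ false ()

-- A block is a pair (j , b) of a column and a symbol. Class zero is unconstrained; the
-- blocks in class suc c have the same trace on the rows placed so far and still need rc c
-- of the m remaining rows, and there is one block for each way of extending the trace.
record Partial (m K V P : ℕ) : Set where
  field
    cls  : Fin K → Fin V → Fin (suc P)
    need : Fin K → Fin V → ℕ
    rc   : Fin P → ℕ
    mult : Fin P → ℕ
    mult≤1 : ∀ c → mult c ≤ 1
    rows  : ∀ j → sum (need j) ≡ m
    consistent : ∀ j b c → cls j b ≡ suc c → need j b ≡ rc c
    count : ∀ c → sum₂ (λ j b → 𝟙 (cls j b F.≟ suc c)) ≡ mult c * (m C rc c)

-- Blocks of class zero are exempt, so padding blocks may have equal row sets.
Separates : ∀ {m K V P} → (Fin K → Fin V → Fin (suc P)) → (Fin m → Fin K → Fin V) → Set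
Separates cls A = ∀ j b j′ b′ c → cls j b ≡ suc c → cls j′ b′ ≡ suc c →
  (∀ r → does (A r j F.≟ b) ≡ does (A r j′ F.≟ b′)) → j ≡ j′ × b ≡ b′

HasSizes : ∀ {m K V} → (Fin K → Fin V → ℕ) → (Fin m → Fin K → Fin V) → Set
HasSizes need A = ∀ j b → sum (λ r → 𝟙 (A r j F.≟ b)) ≡ need j b

module Step {m K V P} (Π : Partial (suc m) K V P) where
  open Partial Π
  open ≡-Reasoning

  -- A class that needs nothing must not receive the row, yet `m C pred 0` is 1. The multiplicity 0
  -- removes this spurious block.
  multIn : ℕ → ℕ → ℕ
  multIn zero μ = 0
  multIn (suc _) μ = μ

  capIn : Fin P → ℕ
  capIn c = multIn (rc c) (mult c) * (m C pred (rc c))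

  w : Fin K → Fin (suc P) → ℕ
  w j t = sum λ b → 𝟙 (cls j b F.≟ t) * need j b

  a : Fin (suc P) → ℕ
  -- All columns not claimed by a constrained class. That this matches the weight of class zero
  -- follows from the total weight `suc m * K`.
  a zero = K ∸ sum capIn
  a (suc c) = capIn c

  w-row : ∀ j → sum (w j) ≡ suc m
  w-row j = begin
    sum (w j) ≡⟨ ∑-comm (λ t b → 𝟙 (cls j b F.≟ t) * need j b) ⟩
    sum (λ b → sum (λ t → 𝟙 (cls j b F.≟ t) * need j b)) ≡⟨ sum-cong-≗ at ⟩
    sum (need j) ≡⟨ rows j ⟩
    suc m ∎
    where
    at : ∀ b → sum (λ t → 𝟙 (cls j b F.≟ t) * need j b) ≡ need j b
    at b = begin
      sum (λ t → 𝟙 (cls j b F.≟ t) * need j b) ≡⟨ *-distribʳ-sum (need j b) (λ t → 𝟙 (cls j b F.≟ t)) ⟨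
      sum (λ t → 𝟙 (cls j b F.≟ t)) * need j b ≡⟨ cong (_* need j b) (trans (sum-cong-≗ λ t → 𝟙-cong (cls j b F.≟ t) (t F.≟ cls j b) sym sym) (sum-𝟙≟ (cls j b))) ⟩
      1 * need j b ≡⟨ *-identityˡ _ ⟩
      need j b ∎

  fraction : ∀ r μ → μ * (suc m C r) * r ≡ suc m * (multIn r μ * (m C pred r))
  fraction zero μ = trans (*-zeroʳ (μ * 1)) (sym (*-zeroʳ (suc m)))
  fraction (suc r) μ = begin
    μ * (suc m C suc r) * suc r   ≡⟨ *-assoc μ _ _ ⟩
    μ * ((suc m C suc r) * suc r) ≡⟨ cong (μ *_) (trans (*-comm (suc m C suc r) (suc r)) (absorption m r)) ⟩
    μ * (suc m * (m C r))         ≡⟨ swap μ (suc m) (m C r) ⟩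
    suc m * (μ * (m C r))         ∎
    where
    swap : ∀ x y z → x * (y * z) ≡ y * (x * z)
    swap = solve-∀

  w-col-suc : ∀ c → sum (λ j → w j (suc c)) ≡ suc m * capIn c
  w-col-suc c = begin
    sum (λ j → w j (suc c)) ≡⟨ sum-cong-≗ (λ j → sum-cong-≗ (at j)) ⟩
    sum₂ (λ j b → 𝟙 (cls j b F.≟ suc c) * rc c) ≡⟨ sum-cong-≗ (λ j → *-distribʳ-sum (rc c) (λ b → 𝟙 (cls j b F.≟ suc c))) ⟨
    sum (λ j → sum (λ b → 𝟙 (cls j b F.≟ suc c)) * rc c) ≡⟨ *-distribʳ-sum (rc c) (λ j → sum (λ b → 𝟙 (cls j b F.≟ suc c))) ⟨
    sum₂ (λ j b → 𝟙 (cls j b F.≟ suc c)) * rc c ≡⟨ cong (_* rc c) (count c) ⟩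
    mult c * (suc m C rc c) * rc c ≡⟨ fraction (rc c) (mult c) ⟩
    suc m * capIn c ∎
    where
    at : ∀ j b → 𝟙 (cls j b F.≟ suc c) * need j b ≡ 𝟙 (cls j b F.≟ suc c) * rc c
    at j b with cls j b F.≟ suc c
    ... | yes p = cong (1 *_) (consistent j b c p)
    ... | no _ = refl

  w-col : ∀ t → sum (λ j → w j t) ≡ suc m * a t
  w-col (suc c) = w-col-suc c
  w-col zero = begin
    W₀                                            ≡⟨ m+n∸n≡m W₀ (suc m * sum capIn) ⟨
    (W₀ + suc m * sum capIn) ∸ suc m * sum capIn  ≡⟨ cong (_∸ suc m * sum capIn) total ⟩
    suc m * K ∸ suc m * sum capIn                 ≡⟨ *-distribˡ-∸ (suc m) K (sum capIn) ⟨
    suc m * (K ∸ sum capIn)                       ∎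
    where
    W₀ = sum (λ j → w j zero)
    total : W₀ + suc m * sum capIn ≡ suc m * K
    total = begin
      W₀ + suc m * sum capIn             ≡⟨ cong (W₀ +_) (*-distribˡ-sum (suc m) capIn) ⟩
      W₀ + sum (λ c → suc m * capIn c)   ≡⟨ cong (W₀ +_) (sum-cong-≗ w-col-suc) ⟨
      sum (λ t → sum (λ j → w j t))      ≡⟨ ∑-comm w ⟨
      sum (λ j → sum (w j))              ≡⟨ sum-cong-≗ w-row ⟩
      sum {K} (λ _ → suc m)              ≡⟨ trans (sum-const K (suc m)) (*-comm K (suc m)) ⟩
      suc m * K                          ∎

  abstract
    assignment : Σ (Fin K → Fin (suc P)) λ g →
      (∀ j → 0 < w j (g j)) × (∀ t → sum (λ j → 𝟙 (g j F.≟ t)) ≡ a t)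
    assignment = regular-assignment w a (suc m) (s≤s z≤n) w-row w-col

  g : Fin K → Fin (suc P)
  g = proj₁ assignment

  abstract
    -- Positive weight only says that some block of the chosen class needs a row; any such block
    -- will do, since blocks of a constrained class have equal needs.
    pick-spec : ∀ j → ∃[ b ] (cls j b ≡ g j × 0 < need j b)
    pick-spec j with sum>0 _ (proj₁ (proj₂ assignment) j)
    ... | b , p with cls j b F.≟ g j
    ...   | yes q = b , q , subst (0 <_) (*-identityˡ _) p

  pick : Fin K → Fin V
  pick j = proj₁ (pick-spec j)

  picked : Fin K → Fin V → Bool
  picked j b = does (pick j F.≟ b)

  cls′ : Fin K → Fin V → Fin (suc (P + P))
  cls′ j b = refine (cls j b) (picked j b)

  need′ : Fin K → Fin V → ℕ
  need′ j b = need j b ∸ 𝟙 (b F.≟ pick j)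

  rc′ mult′ : Fin (P + P) → ℕ
  rc′ c = [ pred ∘ rc , rc ]′ (splitAt P c)
  mult′ c = [ (λ c → multIn (rc c) (mult c)) , mult ]′ (splitAt P c)

  mult′≤1 : ∀ c → mult′ c ≤ 1
  mult′≤1 c with splitAt P c
  ... | inj₂ c = mult≤1 c
  ... | inj₁ c with rc c
  ...   | zero = z≤n
  ...   | suc _ = mult≤1 c

  need′+picked : ∀ j b → need′ j b + 𝟙 (b F.≟ pick j) ≡ need j b
  need′+picked j b = m∸n+n≡m le
    where
    le : 𝟙 (b F.≟ pick j) ≤ need j b
    le with b F.≟ pick j
    ... | yes refl = proj₂ (proj₂ (pick-spec j))
    ... | no _ = z≤n

  rows′ : ∀ j → sum (need′ j) ≡ m
  rows′ j = suc-injective (begin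
    suc (sum (need′ j)) ≡⟨ +-comm 1 _ ⟩
    sum (need′ j) + 1   ≡⟨ cong (sum (need′ j) +_) (sum-𝟙≟ (pick j)) ⟨
    sum (need′ j) + sum (λ b → 𝟙 (b F.≟ pick j)) ≡⟨ ∑-distrib-+ (need′ j) _ ⟨
    sum (λ b → need′ j b + 𝟙 (b F.≟ pick j)) ≡⟨ sum-cong-≗ (need′+picked j) ⟩
    sum (need j) ≡⟨ rows j ⟩
    suc m ∎)

  view : ∀ c → (∃[ c₀ ] (suc c ≡ refine (suc c₀) true × splitAt P c ≡ inj₁ c₀))
             ⊎ (∃[ c₀ ] (suc c ≡ refine (suc c₀) false × splitAt P c ≡ inj₂ c₀))
  view c with splitAt P c in eq
  ... | inj₁ c₀ = inj₁ (c₀ , cong suc (sym (FP.splitAt⁻¹-↑ˡ eq)) , refl)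
  ... | inj₂ c₀ = inj₂ (c₀ , cong suc (sym (FP.splitAt⁻¹-↑ʳ eq)) , refl)

  need-picked : ∀ j b → picked j b ≡ true → need′ j b ≡ pred (need j b)
  need-picked j b p with pick j F.≟ b
  ... | yes refl = trans (cong (need j (pick j) ∸_) (𝟙-yes (pick j F.≟ pick j) refl)) (∸-one (need j (pick j)))
    where
    ∸-one : ∀ n → n ∸ 1 ≡ pred n
    ∸-one zero = refl
    ∸-one (suc n) = refl

  need-unpicked : ∀ j b → picked j b ≡ false → need′ j b ≡ need j b
  need-unpicked j b p with pick j F.≟ b
  ... | no ¬p = cong (need j b ∸_) (𝟙-no (b F.≟ pick j) (¬p ∘ sym))

  consistent′ : ∀ j b c → cls′ j b ≡ suc c → need′ j b ≡ rc′ c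
  consistent′ j b c e with view c
  ... | inj₁ (c₀ , eq , s) with refine-injective (cls j b) c₀ (picked j b) true (trans e eq)
  ...   | q , p = trans (need-picked j b p) (trans (cong pred (consistent j b c₀ q)) (sym (cong [ pred ∘ rc , rc ]′ s)))
  consistent′ j b c e | inj₂ (c₀ , eq , s) with refine-injective (cls j b) c₀ (picked j b) false (trans e eq)
  ...   | q , p = trans (need-unpicked j b p) (trans (consistent j b c₀ q) (sym (cong [ pred ∘ rc , rc ]′ s)))

  -- A column gives the row to a single block, so these blocks correspond to the columns that chose
  -- class `c`.
  count-in : ∀ c → sum₂ (λ j b → 𝟙 (cls′ j b F.≟ refine (suc c) true)) ≡ capIn c
  count-in c = trans (sum-cong-≗ at) (proj₂ (proj₂ assignment) (suc c))
    where
    at : ∀ j → sum (λ b → 𝟙 (cls′ j b F.≟ refine (suc c) true)) ≡ 𝟙 (g j F.≟ suc c)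
    at j = begin
      sum (λ b → 𝟙 (cls′ j b F.≟ refine (suc c) true)) ≡⟨ sum-unique _ (pick j) other ⟩
      𝟙 (cls′ j (pick j) F.≟ refine (suc c) true) ≡⟨ 𝟙-cong (cls′ j (pick j) F.≟ refine (suc c) true) (g j F.≟ suc c) to from ⟩
      𝟙 (g j F.≟ suc c) ∎
      where
      is-picked : picked j (pick j) ≡ true
      is-picked with pick j F.≟ pick j
      ... | yes _ = refl
      ... | no ¬p = ⊥-elim (¬p refl)
      to : cls′ j (pick j) ≡ refine (suc c) true → g j ≡ suc c
      to e = trans (sym (proj₁ (proj₂ (pick-spec j)))) (proj₁ (refine-injective (cls j (pick j)) c _ true e))
      from : g j ≡ suc c → cls′ j (pick j) ≡ refine (suc c) true
      from e = cong₂ refine (trans (proj₁ (proj₂ (pick-spec j))) e) is-picked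
      other : ∀ b → b ≢ pick j → 𝟙 (cls′ j b F.≟ refine (suc c) true) ≡ 0
      other b b≢ = 𝟙-no (cls′ j b F.≟ refine (suc c) true) λ e →
        no-pick (proj₂ (refine-injective (cls j b) c (picked j b) true e))
        where
        no-pick : picked j b ≡ true → ⊥
        no-pick p with pick j F.≟ b
        ... | yes q = b≢ (sym q)

  remaining : ∀ r μ → μ * (suc m C r) ≡ multIn r μ * (m C pred r) + μ * (m C r)
  remaining zero μ = refl
  remaining (suc r) μ = trans (cong (μ *_) (pascal m r)) (*-distribˡ-+ μ _ _)

  -- By Pascal's rule, removing the blocks that receive the row leaves the right number for one row
  -- fewer and an unchanged need.
  count-out : ∀ c → sum₂ (λ j b → 𝟙 (cls′ j b F.≟ refine (suc c) false)) ≡ mult c * (m C rc c)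
  count-out c = +-cancelˡ-≡ (capIn c) _ _ (begin
    capIn c + sum₂ (λ j b → 𝟙 (cls′ j b F.≟ refine (suc c) false)) ≡⟨ cong (_+ sum₂ (λ j b → 𝟙 (cls′ j b F.≟ refine (suc c) false))) (count-in c) ⟨
    sum₂ (λ j b → 𝟙 (cls′ j b F.≟ refine (suc c) true)) + sum₂ (λ j b → 𝟙 (cls′ j b F.≟ refine (suc c) false))
      ≡⟨ sum₂-+ (λ j b → 𝟙 (cls′ j b F.≟ refine (suc c) true)) _ ⟨
    sum₂ (λ j b → 𝟙 (cls′ j b F.≟ refine (suc c) true) + 𝟙 (cls′ j b F.≟ refine (suc c) false))
      ≡⟨ sum-cong-≗ (λ j → sum-cong-≗ (λ b → at (cls j b) (picked j b))) ⟩
    sum₂ (λ j b → 𝟙 (cls j b F.≟ suc c)) ≡⟨ count c ⟩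
    mult c * (suc m C rc c) ≡⟨ remaining (rc c) (mult c) ⟩
    capIn c + mult c * (m C rc c) ∎)
    where
    hit : ∀ t β γ → 𝟙 (refine t β F.≟ refine (suc c) γ) ≡ 𝟙 (β B.≟ γ) * 𝟙 (t F.≟ suc c)
    hit t β γ with β B.≟ γ
    ... | yes refl = trans (𝟙-cong (refine t β F.≟ refine (suc c) β) (t F.≟ suc c)
                       (λ e → proj₁ (refine-injective t c β β e)) (cong (λ t → refine t β))) (sym (*-identityˡ _))
    ... | no β≢γ = 𝟙-no (refine t β F.≟ refine (suc c) γ) λ e → β≢γ (proj₂ (refine-injective t c β γ e))
    at : ∀ t β → 𝟙 (refine t β F.≟ refine (suc c) true) + 𝟙 (refine t β F.≟ refine (suc c) false) ≡ 𝟙 (t F.≟ suc c)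
    at t true = trans (cong₂ _+_ (hit t true true) (hit t true false)) (trans (+-identityʳ _) (*-identityˡ _))
    at t false = trans (cong₂ _+_ (hit t false true) (hit t false false)) (*-identityˡ _)

  count′ : ∀ c → sum₂ (λ j b → 𝟙 (cls′ j b F.≟ suc c)) ≡ mult′ c * (m C rc′ c)
  count′ c with view c
  ... | inj₁ (c₀ , eq , s) rewrite eq | s = count-in c₀
  ... | inj₂ (c₀ , eq , s) rewrite eq | s = count-out c₀

  next : Partial m K V (P + P)
  next = record { cls = cls′ ; need = need′ ; rc = rc′ ; mult = mult′ ; mult≤1 = mult′≤1
                ; rows = rows′ ; consistent = consistent′ ; count = count′ }

-- With no rows left a class has `mult c * (0 C 0)` blocks, at most one, so nothing remains to be
-- separated. In the step, blocks that agree on the new row stay in a common refined class.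
baranyai : ∀ m {K V P} (Π : Partial m K V P) →
  ∃[ A ] (Separates {m} (Partial.cls Π) A × HasSizes (Partial.need Π) A)
baranyai zero {K} {V} Π = (λ ()) , separates ,
  λ j b → sym (n≤0⇒n≡0 (subst (need j b ≤_) (rows j) (≤-sum (need j) b)))
  where
  open Partial Π
  separates : Separates cls (λ ())
  separates j b j′ b′ c e e′ _ =
    sum₂≤1⇒unique (λ j b → 𝟙 (cls j b F.≟ suc c)) at-most-one (hit j b e) (hit j′ b′ e′)
    where
    hit : ∀ j b → cls j b ≡ suc c → 0 < 𝟙 (cls j b F.≟ suc c)
    hit j b e = ≤-reflexive (sym (𝟙-yes (cls j b F.≟ suc c) e))
    rc≡0 : rc c ≡ 0
    rc≡0 = n≤0⇒n≡0 (subst₂ _≤_ (consistent j b c e) (rows j) (≤-sum (need j) b))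
    at-most-one : sum₂ (λ j b → 𝟙 (cls j b F.≟ suc c)) ≤ 1
    at-most-one = subst (_≤ 1) (sym (trans (count c) (trans (cong (λ r → mult c * (0 C r)) rc≡0) (*-identityʳ _)))) (mult≤1 c)
baranyai (suc m) {K} {V} Π = A , separates , sizes
  where
  open Partial Π
  open Step Π
  A′ = baranyai m next
  A : Fin (suc m) → Fin K → Fin V
  A zero = pick
  A (suc r) = proj₁ A′ r
  separates : Separates cls A
  separates j b j′ b′ c e e′ same with cls′ j b in eq
  ... | zero = ⊥-elim (nonzero (cls j b) _ e eq)
    where
    nonzero : ∀ t β → t ≡ suc c → refine t β ≡ zero → ⊥
    nonzero (suc c) true _ ()
    nonzero (suc c) false _ ()
  ... | suc c′ = proj₁ (proj₂ A′) j b j′ b′ c′ eq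
                   (trans (sym (cong₂ refine (trans e (sym e′)) (same zero))) eq) (same ∘ suc)
  sizes : HasSizes need A
  sizes j b = trans (cong₂ _+_ (𝟙-cong (pick j F.≟ b) (b F.≟ pick j) sym sym) (proj₂ (proj₂ A′) j b))
                    (trans (+-comm _ (need′ j b)) (need′+picked j b))

𝟙-does : ∀ {p q} {P : Set p} {Q : Set q} (d : Dec P) (e : Dec Q) → does d ≡ does e → 𝟙 d ≡ 𝟙 e
𝟙-does (yes _) (yes _) _ = refl
𝟙-does (no _) (no _) _ = refl

-- A column with one block of class c, the rest of the rows going to a block of class zero.
module Padding {V P : ℕ} (c : Fin P) (n m : ℕ) where

  padCls : Fin (suc (suc V)) → Fin (suc P)
  padCls zero = suc c
  padCls (suc _) = zero

  padNeed : Fin (suc (suc V)) → ℕ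
  padNeed zero = n
  padNeed (suc zero) = m ∸ n
  padNeed (suc (suc _)) = 0

  padNeed-sum : n ≤ m → sum padNeed ≡ m
  padNeed-sum n≤m = trans (cong (λ z → n + (m ∸ n + z)) (sum-zero {V} (λ _ → refl)))
                          (trans (cong (n +_) (+-identityʳ _)) (m+[n∸m]≡n n≤m))

  padCls-count : ∀ c′ → sum (λ b → 𝟙 (padCls b F.≟ suc c′)) ≡ 𝟙 (c F.≟ c′)
  padCls-count c′ = trans (sum-unique _ zero other) (𝟙-cong (suc c F.≟ suc c′) (c F.≟ c′) FP.suc-injective (cong suc))
    where
    other : ∀ b → b ≢ zero → 𝟙 (padCls b F.≟ suc c′) ≡ 0
    other zero ne = ⊥-elim (ne refl)
    other (suc b) _ = refl

-- `Partial` demands exact counts, whereas the prescribed sizes only respect upper bounds. Each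
-- missing set is supplied by a padding column, and these columns are dropped from the finished
-- array; the fuel exceeds the number of sets still missing.
complete : ∀ fuel {m K V P} (cls : Fin K → Fin (suc (suc V)) → Fin (suc P)) (need : Fin K → Fin (suc (suc V)) → ℕ) (rc : Fin P → ℕ) →
  (∀ j → sum (need j) ≡ m) → (∀ j b c → cls j b ≡ suc c → need j b ≡ rc c) →
  (∀ c → sum₂ (λ j b → 𝟙 (cls j b F.≟ suc c)) ≤ m C rc c) →
  sum (λ c → m C rc c ∸ sum₂ (λ j b → 𝟙 (cls j b F.≟ suc c))) < fuel →
  ∃[ A ] (Separates {m} cls A × HasSizes need A)
complete (suc fuel) {m} {K} {V} {P} cls need rc rows consistent count (s≤s enough)
  with FP.any? (λ c → sum₂ (λ j b → 𝟙 (cls j b F.≟ suc c)) <? m C rc c)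
... | no full = baranyai m (record
  { cls = cls ; need = need ; rc = rc ; mult = λ _ → 1 ; mult≤1 = λ _ → ≤-refl
  ; rows = rows ; consistent = consistent
  ; count = λ c → trans (≤-antisym (count c) (≮⇒≥ λ lt → full (c , lt))) (sym (+-identityʳ _)) })
... | yes (c , lt) = (λ r j → proj₁ A′ r (suc j)) , separates , proj₂ (proj₂ A′) ∘ suc
  where
  open Padding {V} c (rc c) m
  rc≤m : rc c ≤ m
  rc≤m with rc c ≤? m
  ... | yes p = p
  ... | no ¬p = ⊥-elim (n≮0 (subst (_ <_) (k>n⇒nCk≡0 (≰⇒> ¬p)) lt))
  cls′ : Fin (suc K) → Fin (suc (suc V)) → Fin (suc P)
  cls′ zero = padCls
  cls′ (suc j) = cls j
  need′ : Fin (suc K) → Fin (suc (suc V)) → ℕ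
  need′ zero = padNeed
  need′ (suc j) = need j
  rows′ : ∀ j → sum (need′ j) ≡ m
  rows′ zero = padNeed-sum rc≤m
  rows′ (suc j) = rows j
  consistent′ : ∀ j b c′ → cls′ j b ≡ suc c′ → need′ j b ≡ rc c′
  consistent′ zero zero c′ e = cong rc (FP.suc-injective e)
  consistent′ (suc j) b c′ e = consistent j b c′ e
  old new : Fin P → ℕ
  old c′ = sum₂ (λ j b → 𝟙 (cls j b F.≟ suc c′))
  new c′ = sum₂ (λ j b → 𝟙 (cls′ j b F.≟ suc c′))
  new≡ : ∀ c′ → new c′ ≡ 𝟙 (c F.≟ c′) + old c′
  new≡ c′ = cong (_+ old c′) (padCls-count c′)
  count′ : ∀ c′ → new c′ ≤ m C rc c′
  count′ c′ rewrite new≡ c′ with c F.≟ c′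
  ... | yes refl = lt
  ... | no _ = count c′
  old≤new : ∀ c′ → old c′ ≤ new c′
  old≤new c′ = subst (old c′ ≤_) (sym (new≡ c′)) (m≤n+m _ _)
  old<new : old c < new c
  old<new = ≤-reflexive (sym (trans (new≡ c) (cong (_+ old c) (𝟙-yes (c F.≟ c) refl))))
  A′ = complete fuel cls′ need′ rc rows′ consistent′ count′
         (<-≤-trans (sum-mono-< (λ c′ → ∸-monoʳ-≤ (m C rc c′) (old≤new c′)) c (∸-monoʳ-< old<new (count′ c))) enough)
  separates : Separates cls (λ r j → proj₁ A′ r (suc j))
  separates j b j′ b′ c′ e e′ same with proj₁ (proj₂ A′) (suc j) b (suc j′) b′ c′ e e′ same
  ... | p , q = FP.suc-injective p , q

-- Before any row is placed all traces are empty, so the class of a block is its size. Blocks with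
-- equal row sets have equal sizes, hence a common class, and separation applies.
realize : ∀ N K {V} (s : Fin K → Fin (suc (suc V)) → ℕ) → (∀ j → sum (s j) ≡ N) →
  (∀ i → sum₂ (λ j b → 𝟙 (s j b ≟ i)) ≤ N C i) → ∃[ A ] Is11LA {N} {K} {suc (suc V)} A
realize N K {V} s rows count = A , is11LA
  where
  s<1+N : ∀ j b → s j b < suc N
  s<1+N j b = s≤s (subst (s j b ≤_) (rows j) (≤-sum (s j) b))
  cls : Fin K → Fin (suc (suc V)) → Fin (suc (suc N))
  cls j b = suc (fromℕ< (s<1+N j b))
  consistent : ∀ j b c → cls j b ≡ suc c → s j b ≡ toℕ c
  consistent j b c e = trans (sym (FP.toℕ-fromℕ< (s<1+N j b))) (cong toℕ (FP.suc-injective e))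
  count′ : ∀ c → sum₂ (λ j b → 𝟙 (cls j b F.≟ suc c)) ≤ N C toℕ c
  count′ c = ≤-trans (sum-mono-≤ λ j → sum-mono-≤ λ b → 𝟙-mono (cls j b F.≟ suc c) (s j b ≟ toℕ c) (consistent j b c)) (count (toℕ c))
  solution = complete _ cls s toℕ rows consistent count′ ≤-refl
  A = proj₁ solution
  is11LA : Is11LA A
  is11LA j j′ b b′ e = proj₁ (proj₂ solution) j b j′ b′ _ refl same-class same
    where
    same : ∀ r → does (A r j F.≟ b) ≡ does (A r j′ F.≟ b′)
    same r = begin
      does (A r j F.≟ b)       ≡⟨ isYes≗does (A r j F.≟ b) ⟨
      ⌊ A r j F.≟ b ⌋          ≡⟨ lookup∘tabulate (λ r → ⌊ A r j F.≟ b ⌋) r ⟨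
      lookup (ρ A j b) r       ≡⟨ cong (λ X → lookup X r) e ⟩
      lookup (ρ A j′ b′) r     ≡⟨ lookup∘tabulate (λ r → ⌊ A r j′ F.≟ b′ ⌋) r ⟩
      ⌊ A r j′ F.≟ b′ ⌋        ≡⟨ isYes≗does (A r j′ F.≟ b′) ⟩
      does (A r j′ F.≟ b′)     ∎
      where open ≡-Reasoning
    same-size : s j b ≡ s j′ b′
    same-size = begin
      s j b                           ≡⟨ proj₂ (proj₂ solution) j b ⟨
      sum (λ r → 𝟙 (A r j F.≟ b))     ≡⟨ sum-cong-≗ (λ r → 𝟙-does (A r j F.≟ b) (A r j′ F.≟ b′) (same r)) ⟩
      sum (λ r → 𝟙 (A r j′ F.≟ b′))   ≡⟨ proj₂ (proj₂ solution) j′ b′ ⟩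
      s j′ b′                         ∎
      where open ≡-Reasoning
    same-class : cls j′ b′ ≡ cls j b
    same-class = cong suc (FP.fromℕ<-cong _ _ (sym same-size) (s<1+N j′ b′) (s<1+N j b))

-- The upper bound: weighing distinct sets.

∑< : ℕ → (ℕ → ℕ) → ℕ
∑< n g = sum {n} (g ∘ toℕ)

-- The sum of w(|X|) over all subsets X of an N-element set, split by whether X contains the first
-- element.
total : ℕ → (ℕ → ℕ) → ℕ
total zero w = w 0
total (suc N) w = total N w + total N (w ∘ suc)

total-binomial : ∀ N M w → (∀ i → M ≤ i → w i ≡ 0) → total N w ≡ ∑< M (λ i → (N C i) * w i)
total-binomial N zero w vanish = all-zero N w (λ i → vanish i z≤n)
  where
  all-zero : ∀ N w → (∀ i → w i ≡ 0) → total N w ≡ 0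
  all-zero zero w h = h 0
  all-zero (suc N) w h = cong₂ _+_ (all-zero N w h) (all-zero N (w ∘ suc) (h ∘ suc))
total-binomial zero (suc M) w vanish = begin
  w 0                                     ≡⟨ +-identityʳ _ ⟨
  w 0 + 0                                 ≡⟨ cong (_+ 0) (*-identityˡ (w 0)) ⟨
  1 * w 0 + 0                             ≡⟨ cong (1 * w 0 +_) (sum-zero {M} (λ i → cong (_* w (suc (toℕ i))) (k>n⇒nCk≡0 {0} {suc (toℕ i)} (s≤s z≤n)))) ⟨
  ∑< (suc M) (λ i → (0 C i) * w i)          ∎
  where open ≡-Reasoning
total-binomial (suc N) (suc M) w vanish = begin
  total N w + total N (w ∘ suc)
    ≡⟨ cong₂ _+_ (total-binomial N (suc M) w vanish) (total-binomial N M (w ∘ suc) (λ i p → vanish (suc i) (s≤s p))) ⟩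
  1 * w 0 + ∑< M (λ i → (N C suc i) * w (suc i)) + ∑< M (λ i → (N C i) * w (suc i))
    ≡⟨ +-assoc (1 * w 0) _ _ ⟩
  1 * w 0 + (∑< M (λ i → (N C suc i) * w (suc i)) + ∑< M (λ i → (N C i) * w (suc i)))
    ≡⟨ cong (1 * w 0 +_) (∑-distrib-+ {M} (λ i → (N C suc (toℕ i)) * w (suc (toℕ i))) _) ⟨
  1 * w 0 + ∑< M (λ i → (N C suc i) * w (suc i) + (N C i) * w (suc i))
    ≡⟨ cong (1 * w 0 +_) (sum-cong-≗ {M} (λ i → at (toℕ i))) ⟩
  ∑< (suc M) (λ i → (suc N C i) * w i) ∎
  where
  open ≡-Reasoning
  at : ∀ i → (N C suc i) * w (suc i) + (N C i) * w (suc i) ≡ (suc N C suc i) * w (suc i)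
  at i = begin
    (N C suc i) * w (suc i) + (N C i) * w (suc i) ≡⟨ *-distribʳ-+ (w (suc i)) (N C suc i) _ ⟨
    (N C suc i + N C i) * w (suc i)           ≡⟨ cong (_* w (suc i)) (trans (+-comm (N C suc i) _) (sym (pascal N i))) ⟩
    (suc N C suc i) * w (suc i)                 ∎

unique⇒sum₂≤1 : ∀ {K V} (f : Fin K → Fin V → ℕ) → (∀ j b → f j b ≤ 1) →
  (∀ j b j′ b′ → 0 < f j b → 0 < f j′ b′ → j ≡ j′ × b ≡ b′) → sum₂ f ≤ 1
unique⇒sum₂≤1 f f≤1 unique with sum₂ f in eq
... | zero = z≤n
... | suc _ with sum>0 (sum ∘ f) (subst (0 <_) (sym eq) (s≤s z≤n))
...   | j , p with sum>0 (f j) p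
...     | b , q = subst (_≤ 1) (sym (trans (sym eq) (trans (sum-unique (sum ∘ f) j other-row) (sum-unique (f j) b other)))) (f≤1 j b)
  where
  other : ∀ b′ → b′ ≢ b → f j b′ ≡ 0
  other b′ ne = n≤0⇒n≡0 (≮⇒≥ λ p → ne (proj₂ (unique j b′ j b p q)))
  other-row : ∀ j′ → j′ ≢ j → sum (f j′) ≡ 0
  other-row j′ ne = sum-zero λ b′ → n≤0⇒n≡0 (≮⇒≥ λ p → ne (proj₁ (unique j′ b′ j b p q)))

card : ∀ {N} → (Fin N → Bool) → ℕ
card X = sum λ r → 𝟙 (X r B.≟ true)

-- The mask `u` lets the recursion divide the family by membership of the first row without
-- reindexing it.
distinct-sets : ∀ N {K V} (u : Fin K → Fin V → Bool) (X : Fin K → Fin V → Fin N → Bool) →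
  (∀ j b j′ b′ → u j b ≡ true → u j′ b′ ≡ true → (∀ r → X j b r ≡ X j′ b′ r) → j ≡ j′ × b ≡ b′) →
  ∀ w → sum₂ (λ j b → 𝟙 (u j b B.≟ true) * w (card (X j b))) ≤ total N w
distinct-sets zero u X inj w = begin
  sum₂ (λ j b → 𝟙 (u j b B.≟ true) * w 0)  ≡⟨ sum-cong-≗ (λ j → *-distribʳ-sum (w 0) (λ b → 𝟙 (u j b B.≟ true))) ⟨
  sum (λ j → sum (λ b → 𝟙 (u j b B.≟ true)) * w 0) ≡⟨ *-distribʳ-sum (w 0) (λ j → sum (λ b → 𝟙 (u j b B.≟ true))) ⟨
  sum₂ (λ j b → 𝟙 (u j b B.≟ true)) * w 0  ≤⟨ *-monoˡ-≤ (w 0) (unique⇒sum₂≤1 _ (λ j b → 𝟙≤1 (u j b B.≟ true))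
                                                λ j b j′ b′ p q → inj j b j′ b′ (𝟙>0 (u j b B.≟ true) p) (𝟙>0 (u j′ b′ B.≟ true) q) λ ()) ⟩
  1 * w 0                                  ≡⟨ *-identityˡ _ ⟩
  w 0                                      ∎
  where open ≤-Reasoning
distinct-sets (suc N) {K} {V} u X inj w = begin
  sum₂ (λ j b → 𝟙 (u j b B.≟ true) * w (card (X j b)))
    ≡⟨ sum-cong-≗ (λ j → sum-cong-≗ (λ b → at (u j b) (X j b zero) (card (X′ j b)))) ⟩
  sum₂ (λ j b → part false j b + part true j b)
    ≡⟨ sum₂-+ (part false) (part true) ⟩
  sum₂ (part false) + sum₂ (part true)
    ≤⟨ +-mono-≤ (distinct-sets N (active false) X′ (inj′ false) w) (distinct-sets N (active true) X′ (inj′ true) (w ∘ suc)) ⟩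
  total N w + total N (w ∘ suc) ∎
  where
  open ≤-Reasoning
  X′ : Fin K → Fin V → Fin N → Bool
  X′ j b = X j b ∘ suc
  active : Bool → Fin K → Fin V → Bool
  active β j b = u j b ∧ does (X j b zero B.≟ β)
  part : Bool → Fin K → Fin V → ℕ
  part β j b = 𝟙 (active β j b B.≟ true) * w (if β then suc (card (X′ j b)) else card (X′ j b))
  at : ∀ u x n → 𝟙 (u B.≟ true) * w (𝟙 (x B.≟ true) + n)
     ≡ 𝟙 ((u ∧ does (x B.≟ false)) B.≟ true) * w n + 𝟙 ((u ∧ does (x B.≟ true)) B.≟ true) * w (suc n)
  at false x n = refl
  at true false n = sym (+-identityʳ _)
  at true true n = refl
  active⇒ : ∀ β u x → u ∧ does (x B.≟ β) ≡ true → u ≡ true × x ≡ β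
  active⇒ β true x e with x B.≟ β
  ... | yes p = refl , p
  inj′ : ∀ β j b j′ b′ → active β j b ≡ true → active β j′ b′ ≡ true → (∀ r → X′ j b r ≡ X′ j′ b′ r) → j ≡ j′ × b ≡ b′
  inj′ β j b j′ b′ p q e with active⇒ β (u j b) (X j b zero) p | active⇒ β (u j′ b′) (X j′ b′ zero) q
  ... | up , xp | uq , xq = inj j b j′ b′ up uq λ { zero → trans xp (sym xq) ; (suc r) → e r }

⊓-+-≤ : ∀ d x y → d ⊓ (x + y) ≤ d ⊓ x + d ⊓ y
⊓-+-≤ d x y with ≤-total d x
... | inj₁ d≤x = ≤-trans (m⊓n≤m d _) (≤-trans (≤-reflexive (sym (m≤n⇒m⊓n≡m d≤x))) (m≤m+n _ _))
... | inj₂ x≤d with ≤-total d y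
...   | inj₁ d≤y = ≤-trans (m⊓n≤m d _) (≤-trans (≤-reflexive (sym (m≤n⇒m⊓n≡m d≤y))) (m≤n+m _ _))
...   | inj₂ y≤d = ≤-trans (m⊓n≤n d _) (≤-reflexive (cong₂ _+_ (sym (m≥n⇒m⊓n≡n x≤d)) (sym (m≥n⇒m⊓n≡n y≤d))))

⊓-sum-≤ : ∀ {n} d (g : Fin n → ℕ) → d ⊓ sum g ≤ sum (λ i → d ⊓ g i)
⊓-sum-≤ {zero} d g = ≤-reflexive (⊓-zeroʳ d)
⊓-sum-≤ {suc n} d g = ≤-trans (⊓-+-≤ d (g zero) _) (+-monoʳ-≤ (d ⊓ g zero) (⊓-sum-≤ d (g ∘ suc)))

weight : ℕ → ℕ → ℕ → ℕ
weight f d i = d ⊓ (suc f ∸ i)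

-- A size above f + 1 has negative deficit, which truncation raises to 0, so the truncated deficits
-- add up to at least d. Subadditivity of capping at d gives the rest.
column-weight : ∀ {N v f d} → N + d ≡ suc f * v → (s : Fin v → ℕ) → sum s ≡ N → d ≤ sum (λ b → weight f d (s b))
column-weight {N} {v} {f} {d} eq s s≡N = begin
  d                              ≡⟨ m≤n⇒m⊓n≡m deficit ⟨
  d ⊓ sum (λ b → suc f ∸ s b)    ≤⟨ ⊓-sum-≤ d (λ b → suc f ∸ s b) ⟩
  sum (λ b → weight f d (s b))   ∎
  where
  open ≤-Reasoning
  deficit : d ≤ sum (λ b → suc f ∸ s b)
  deficit = +-cancelˡ-≤ N _ _ (begin
    N + d                                    ≡⟨ trans eq (*-comm (suc f) v) ⟩
    v * suc f                                ≡⟨ sum-const v (suc f) ⟨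
    sum {v} (λ _ → suc f)                    ≤⟨ sum-mono-≤ (λ b → m≤n+m∸n (suc f) (s b)) ⟩
    sum (λ b → s b + (suc f ∸ s b))          ≡⟨ ∑-distrib-+ s _ ⟩
    sum s + sum (λ b → suc f ∸ s b)          ≡⟨ cong (_+ sum (λ b → suc f ∸ s b)) s≡N ⟩
    N + sum (λ b → suc f ∸ s b)              ∎)

upper-bound : ∀ {N v f d} → N + d ≡ suc f * v → ∀ {k} (A : Array N k v) → Is11LA A →
  k * d ≤ ∑< (suc f) (λ i → (N C i) * weight f d i)
upper-bound {N} {v} {f} {d} eq {k} A la = begin
  k * d                                       ≡⟨ sum-const k d ⟨
  sum {k} (λ _ → d)                           ≤⟨ sum-mono-≤ (λ j → column-weight eq (λ b → card (X j b)) (sizes j)) ⟩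
  sum₂ (λ j b → weight f d (card (X j b)))    ≡⟨ sum-cong-≗ (λ j → sum-cong-≗ {v} λ b → *-identityˡ (weight f d (card (X j b)))) ⟨
  sum₂ (λ j b → 1 * weight f d (card (X j b))) ≤⟨ distinct-sets N (λ _ _ → true) X distinct (weight f d) ⟩
  total N (weight f d)                        ≡⟨ total-binomial N (suc f) (weight f d) (λ i p → trans (cong (d ⊓_) (m≤n⇒m∸n≡0 p)) (⊓-zeroʳ d)) ⟩
  ∑< (suc f) (λ i → (N C i) * weight f d i)     ∎
  where
  open ≤-Reasoning
  X : Fin k → Fin v → Fin N → Bool
  X j b r = ⌊ A r j F.≟ b ⌋
  distinct : ∀ j b j′ b′ → true ≡ true → true ≡ true → (∀ r → X j b r ≡ X j′ b′ r) → j ≡ j′ × b ≡ b′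
  distinct j b j′ b′ _ _ same = la j j′ b b′ (tabulate-cong same)
  sizes : ∀ j → sum (λ b → card (X j b)) ≡ N
  sizes j = begin-equality
    sum (λ b → card (X j b))                    ≡⟨ ∑-comm (λ b r → 𝟙 (X j b r B.≟ true)) ⟩
    sum (λ r → sum (λ b → 𝟙 (X j b r B.≟ true))) ≡⟨ sum-cong-≗ (λ r → trans (sum-cong-≗ (λ b → at r b)) (sum-𝟙≟ (A r j))) ⟩
    sum {N} (λ _ → 1)                           ≡⟨ trans (sum-const N 1) (*-identityʳ N) ⟩
    N                                           ∎
    where
    at : ∀ r b → 𝟙 (X j b r B.≟ true) ≡ 𝟙 (b F.≟ A r j)
    at r b with A r j F.≟ b
    ... | yes p = sym (𝟙-yes (b F.≟ A r j) (sym p))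
    ... | no ¬p = sym (𝟙-no (b F.≟ A r j) (¬p ∘ sym))

-- Evaluating the closed formula.

∑<-split : ∀ m n g → ∑< (m + n) g ≡ ∑< m g + ∑< n (g ∘ (m +_))
∑<-split zero n g = refl
∑<-split (suc m) n g = trans (cong (g 0 +_) (∑<-split m n (g ∘ suc))) (sym (+-assoc (g 0) _ _))

∑<-cong : ∀ n {g h : ℕ → ℕ} → (∀ i → i < n → g i ≡ h i) → ∑< n g ≡ ∑< n h
∑<-cong n e = sum-cong-≗ λ i → e (toℕ i) (FP.toℕ<n i)

sum-applyUpTo : ∀ n (k h : ℕ → ℕ) → List.sum (map h (applyUpTo k n)) ≡ ∑< n (h ∘ k)
sum-applyUpTo zero k h = refl
sum-applyUpTo (suc n) k h = cong (h (k 0) +_) (sum-applyUpTo n (k ∘ suc) h)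

sumRange-∑< : ∀ a b n g → b ℤ.+ pos 1 ℤ.- a ≡ pos n → sumRange a b g ≡ ∑< n (λ i → g (a ℤ.+ pos i))
sumRange-∑< a b n g e rewrite e = sum-applyUpTo n id (λ i → g (a ℤ.+ pos i))

clamp-⊖ : ∀ a b → clamp (a ℤ.⊖ b) ≡ a ∸ b
clamp-⊖ a b with ≤-total b a
... | inj₁ b≤a = cong clamp (ℤP.⊖-≥ b≤a)
... | inj₂ a≤b = trans (cong clamp (ℤP.⊖-≤ a≤b)) (trans (clamp-neg (b ∸ a)) (sym (m≤n⇒m∸n≡0 a≤b)))
  where
  clamp-neg : ∀ n → clamp (ℤ.- pos n) ≡ 0
  clamp-neg zero = refl
  clamp-neg (suc n) = refl

binomℤ-negative : ∀ N {n m} → n < m → binomℤ N (n ℤ.⊖ m) ≡ 0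
binomℤ-negative N {n} {m} n<m = trans (cong (binomℤ N) (ℤP.⊖-< n<m)) (neg (m<n⇒0<n∸m n<m))
  where
  neg : ∀ {k} → 0 < k → binomℤ N (ℤ.- pos k) ≡ 0
  neg (s≤s _) = refl

weightSum : ℕ → ℕ → ℕ → ℕ
weightSum N f d = ∑< (suc f) (λ i → (N C i) * weight f d i)

-- The formula with its integer copy of d as a separate argument, so that it can be replaced by
-- `pos d`.
ΛAt : ℕ → ℕ → ℕ → ℤ → ℕ
ΛAt N f d dz =
  (sumRange (pos f ℤ.- dz ℤ.+ pos 2) (pos f) (λ i → clamp (pos f ℤ.+ pos 1 ℤ.- i) * binomℤ N i)) div′ d
  + sumRange (pos 0) (pos f ℤ.- dz ℤ.+ pos 1) (binomℤ N)

-- Sizes up to f - d + 1 have weight exactly d; their contribution is a multiple of d and leaves the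
-- floor as the second sum. The other sizes have weight f + 1 - i.
ΛAt-weightSum : ∀ N f e → ΛAt N f (2 + e) (pos (2 + e)) ≡ weightSum N f (2 + e) / (2 + e)
ΛAt-weightSum N f e with ≤-<-connex e f
... | inj₁ e≤f with m≤n⇒∃[o]m+o≡n e≤f
...   | g , refl = begin
  R₁ / d + R₂                        ≡⟨ cong₂ (λ x y → x / d + y) R₁≡ R₂≡ ⟩
  S₁ / d + S₂                        ≡⟨ cong (S₁ / d +_) (m*n/n≡m S₂ d) ⟨
  S₁ / d + S₂ * d / d                ≡⟨ +-distrib-/-∣ʳ S₁ (divides S₂ refl) ⟨
  (S₁ + S₂ * d) / d                  ≡⟨ cong (_/ d) T≡ ⟨
  weightSum N f d / d                ∎
  where
  open ≡-Reasoning
  d = 2 + e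
  R₁ = sumRange (pos f ℤ.- pos d ℤ.+ pos 2) (pos f) (λ i → clamp (pos f ℤ.+ pos 1 ℤ.- i) * binomℤ N i)
  R₂ = sumRange (pos 0) (pos f ℤ.- pos d ℤ.+ pos 1) (binomℤ N)
  S₁ = ∑< (suc e) (λ i → (suc f ∸ (g + i)) * (N C (g + i)))
  S₂ = ∑< g (N C_)
  lower : ∀ e g → e ℤ.+ g ℤ.- (pos 2 ℤ.+ e) ℤ.+ pos 2 ≡ g
  lower = ℤS.solve-∀
  count₁ : ∀ e g → e ℤ.+ g ℤ.+ pos 1 ℤ.- g ≡ pos 1 ℤ.+ e
  count₁ = ℤS.solve-∀
  count₂ : ∀ e g → e ℤ.+ g ℤ.- (pos 2 ℤ.+ e) ℤ.+ pos 1 ℤ.+ pos 1 ℤ.- pos 0 ≡ g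
  count₂ = ℤS.solve-∀
  R₁≡ : R₁ ≡ S₁
  R₁≡ = begin
    R₁ ≡⟨ cong (λ a → sumRange a (pos f) (λ i → clamp (pos f ℤ.+ pos 1 ℤ.- i) * binomℤ N i)) (lower (pos e) (pos g)) ⟩
    sumRange (pos g) (pos f) (λ i → clamp (pos f ℤ.+ pos 1 ℤ.- i) * binomℤ N i)
       ≡⟨ sumRange-∑< (pos g) (pos f) (suc e) (λ i → clamp (pos f ℤ.+ pos 1 ℤ.- i) * binomℤ N i) (count₁ (pos e) (pos g)) ⟩
    ∑< (suc e) (λ i → clamp (pos (f + 1) ℤ.- pos (g + i)) * (N C (g + i)))
       ≡⟨ ∑<-cong (suc e) (λ i _ → cong (_* (N C (g + i))) (trans (cong clamp (ℤP.m-n≡m⊖n (f + 1) (g + i)))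
            (trans (clamp-⊖ (f + 1) (g + i)) (cong (_∸ (g + i)) (+-comm f 1))))) ⟩
    S₁ ∎
  R₂≡ : R₂ ≡ S₂
  R₂≡ = sumRange-∑< (pos 0) (pos f ℤ.- pos d ℤ.+ pos 1) g (binomℤ N) (count₂ (pos e) (pos g))
  T≡ : weightSum N f d ≡ S₁ + S₂ * d
  T≡ = begin
    weightSum N f d ≡⟨ cong (λ n → ∑< n (λ i → (N C i) * weight f d i)) (trans (cong suc (+-comm e g)) (sym (+-suc g e))) ⟩
    ∑< (g + suc e) (λ i → (N C i) * weight f d i) ≡⟨ ∑<-split g (suc e) (λ i → (N C i) * weight f d i) ⟩
    ∑< g (λ i → (N C i) * weight f d i) + ∑< (suc e) (λ i → (N C (g + i)) * weight f d (g + i))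
      ≡⟨ cong₂ _+_ (∑<-cong g (λ i i<g → cong ((N C i) *_) (full i i<g))) (∑<-cong (suc e) (λ i _ → partial i)) ⟩
    ∑< g (λ i → (N C i) * d) + S₁ ≡⟨ cong (_+ S₁) (*-distribʳ-sum {g} d (λ i → N C toℕ i)) ⟨
    S₂ * d + S₁ ≡⟨ +-comm (S₂ * d) S₁ ⟩
    S₁ + S₂ * d ∎
    where
    full : ∀ i → i < g → weight f d i ≡ d
    full i i<g = m≤n⇒m⊓n≡m (m+n≤o⇒m≤o∸n d (s≤s (≤-trans (≤-reflexive (sym (+-suc e i))) (+-monoʳ-≤ e i<g))))
    partial : ∀ i → (N C (g + i)) * weight f d (g + i) ≡ (suc f ∸ (g + i)) * (N C (g + i))
    partial i = trans (*-comm (N C (g + i)) _) (cong (_* (N C (g + i))) (m≥n⇒m⊓n≡n at-most))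
      where
      at-most : suc f ∸ (g + i) ≤ d
      at-most = ≤-trans (∸-monoʳ-≤ (suc f) (m≤m+n g i)) (≤-trans (≤-reflexive (m+n∸n≡m (suc e) g)) (n≤1+n _))
-- Now d ≥ f + 3: the first range begins below 0, where the binomial coefficients vanish, and the
-- second is empty.
ΛAt-weightSum N f e | inj₂ f<e with m≤n⇒∃[o]m+o≡n f<e
...   | h , refl = begin
  R₁ / d + R₂                        ≡⟨ cong₂ (λ x y → x / d + y) R₁≡ R₂≡ ⟩
  weightSum N f d / d + 0            ≡⟨ +-identityʳ _ ⟩
  weightSum N f d / d                ∎
  where
  open ≡-Reasoning
  d = 2 + e
  R₁ = sumRange (pos f ℤ.- pos d ℤ.+ pos 2) (pos f) (λ i → clamp (pos f ℤ.+ pos 1 ℤ.- i) * binomℤ N i)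
  R₂ = sumRange (pos 0) (pos f ℤ.- pos d ℤ.+ pos 1) (binomℤ N)
  lower : ∀ f h → f ℤ.- (pos 2 ℤ.+ (pos 1 ℤ.+ f ℤ.+ h)) ℤ.+ pos 2 ≡ ℤ.- (pos 1 ℤ.+ h)
  lower = ℤS.solve-∀
  count₁ : ∀ f h → f ℤ.+ pos 1 ℤ.- ℤ.- (pos 1 ℤ.+ h) ≡ pos 1 ℤ.+ h ℤ.+ (pos 1 ℤ.+ f)
  count₁ = ℤS.solve-∀
  count₂ : ∀ f h → f ℤ.- (pos 2 ℤ.+ (pos 1 ℤ.+ f ℤ.+ h)) ℤ.+ pos 1 ℤ.+ pos 1 ℤ.- pos 0 ≡ ℤ.- (pos 1 ℤ.+ h)
  count₂ = ℤS.solve-∀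
  shift : ∀ h i → ℤ.- (pos 1 ℤ.+ h) ℤ.+ (pos 1 ℤ.+ h ℤ.+ i) ≡ i
  shift = ℤS.solve-∀
  term : ℤ → ℕ
  term i = clamp (pos f ℤ.+ pos 1 ℤ.- i) * binomℤ N i
  R₁≡ : R₁ ≡ weightSum N f d
  R₁≡ = begin
    R₁ ≡⟨ cong (λ a → sumRange a (pos f) term) (lower (pos f) (pos h)) ⟩
    sumRange -[1+ h ] (pos f) term ≡⟨ sumRange-∑< -[1+ h ] (pos f) (suc h + suc f) term (count₁ (pos f) (pos h)) ⟩
    ∑< (suc h + suc f) (λ i → term (-[1+ h ] ℤ.+ pos i)) ≡⟨ ∑<-split (suc h) (suc f) (λ i → term (-[1+ h ] ℤ.+ pos i)) ⟩
    ∑< (suc h) (λ i → term (-[1+ h ] ℤ.+ pos i)) + ∑< (suc f) (λ i → term (-[1+ h ] ℤ.+ pos (suc h + i)))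
      ≡⟨ cong₂ _+_ (sum-zero {suc h} λ i → below (toℕ i) (FP.toℕ<n i)) (∑<-cong (suc f) above) ⟩
    weightSum N f d ∎
    where
    below : ∀ i → i < suc h → term (-[1+ h ] ℤ.+ pos i) ≡ 0
    below i i≤h = trans (cong (clamp (pos f ℤ.+ pos 1 ℤ.- (-[1+ h ] ℤ.+ pos i)) *_) (binomℤ-negative N i≤h)) (*-zeroʳ (clamp (pos f ℤ.+ pos 1 ℤ.- (-[1+ h ] ℤ.+ pos i))))
    above : ∀ i → i < suc f → term (-[1+ h ] ℤ.+ pos (suc h + i)) ≡ (N C i) * weight f d i
    above i i≤f = begin
      term (-[1+ h ] ℤ.+ pos (suc h + i)) ≡⟨ cong term (shift (pos h) (pos i)) ⟩
      clamp (pos (f + 1) ℤ.- pos i) * (N C i) ≡⟨ cong (_* (N C i)) (trans (cong clamp (ℤP.m-n≡m⊖n (f + 1) i)) (trans (clamp-⊖ (f + 1) i) (cong (_∸ i) (+-comm f 1)))) ⟩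
      (suc f ∸ i) * (N C i) ≡⟨ *-comm (suc f ∸ i) (N C i) ⟩
      (N C i) * (suc f ∸ i) ≡⟨ cong ((N C i) *_) (m≥n⇒m⊓n≡n {d} (≤-trans (m∸n≤m (suc f) i) (≤-trans (≤-trans (m≤m+n (suc f) h) (n≤1+n _)) (n≤1+n _)))) ⟨
      (N C i) * weight f d i ∎
  R₂≡ : R₂ ≡ 0
  R₂≡ rewrite count₂ (pos f) (pos h) = refl

∑<-suc : ∀ n g → ∑< (suc n) g ≡ ∑< n g + g n
∑<-suc zero g = +-comm (g 0) 0
∑<-suc (suc n) g = trans (cong (g 0 +_) (∑<-suc n (g ∘ suc))) (sym (+-assoc (g 0) _ _))

∑<-zero : ∀ n {g : ℕ → ℕ} → (∀ i → i < n → g i ≡ 0) → ∑< n g ≡ 0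
∑<-zero n z = sum-zero {n} λ i → z (toℕ i) (FP.toℕ<n i)

∑<-lone : ∀ n (g : ℕ → ℕ) M → (∀ i → i < n → 0 < g i → g i ≤ M) →
  (∀ i j → i < n → j < n → 0 < g i → 0 < g j → i ≡ j) → ∑< n g ≤ M
∑<-lone n g M bound unique with ∑< n g in eq
... | zero = z≤n
... | suc _ with sum>0 {n} (g ∘ toℕ) (subst (0 <_) (sym eq) (s≤s z≤n))
...   | k , p = subst (_≤ M) (trans (sym (sum-unique (g ∘ toℕ) k others)) eq) (bound (toℕ k) (FP.toℕ<n k) p)
  where
  others : ∀ i → i ≢ k → g (toℕ i) ≡ 0
  others i i≢k = n≤0⇒n≡0 (≮⇒≥ λ q → i≢k (FP.toℕ-injective (unique (toℕ i) (toℕ k) (FP.toℕ<n i) (FP.toℕ<n k) q p)))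

-- Columns as lists of class sizes.

occ : ℕ → List ℕ → ℕ
occ s [] = 0
occ s (x ∷ xs) = 𝟙 (x ≟ s) + occ s xs

occ-++ : ∀ s xs ys → occ s (xs ++ ys) ≡ occ s xs + occ s ys
occ-++ s [] ys = refl
occ-++ s (x ∷ xs) ys = trans (cong (𝟙 (x ≟ s) +_) (occ-++ s xs ys)) (sym (+-assoc (𝟙 (x ≟ s)) _ _))

occ-replicate : ∀ s n x → occ s (replicate n x) ≡ n * 𝟙 (x ≟ s)
occ-replicate s zero x = refl
occ-replicate s (suc n) x = cong (𝟙 (x ≟ s) +_) (occ-replicate s n x)

occs : ℕ → List (List ℕ) → ℕ
occs s [] = 0
occs s (r ∷ rs) = occ s r + occs s rs

occs-++ : ∀ s xs ys → occs s (xs ++ ys) ≡ occs s xs + occs s ys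
occs-++ s [] ys = refl
occs-++ s (x ∷ xs) ys = trans (cong (occ s x +_) (occs-++ s xs ys)) (sym (+-assoc (occ s x) _ _))

occs-replicate : ∀ s n r → occs s (replicate n r) ≡ n * occ s r
occs-replicate s zero r = refl
occs-replicate s (suc n) r = cong (occ s r +_) (occs-replicate s n r)

sum-replicate : ∀ n x → List.sum (replicate n x) ≡ n * x
sum-replicate zero x = refl
sum-replicate (suc n) x = cong (x +_) (sum-replicate n x)

Shape : ℕ → ℕ → List ℕ → Set
Shape N v r = length r ≡ v × List.sum r ≡ N

record Shapes (N v : ℕ) (c : ℕ → ℕ) (K : ℕ) : Set where
  field
    list   : List (List ℕ)
    shape  : All (Shape N v) list
    amount : length list ≡ K
    occs≤c : ∀ s → occs s list ≤ c s

-- The default 0 never matters: lists of length v are read only at positions below v.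
nth : List ℕ → ℕ → ℕ
nth [] i = 0
nth (x ∷ xs) zero = x
nth (x ∷ xs) (suc i) = nth xs i

sum-nth : ∀ r {v} → length r ≡ v → sum {v} (λ b → nth r (toℕ b)) ≡ List.sum r
sum-nth [] refl = refl
sum-nth (x ∷ r) refl = cong (x +_) (sum-nth r refl)

occ-nth : ∀ s r {v} → length r ≡ v → sum {v} (λ b → 𝟙 (nth r (toℕ b) ≟ s)) ≡ occ s r
occ-nth s [] refl = refl
occ-nth s (x ∷ r) refl = cong (𝟙 (x ≟ s) +_) (occ-nth s r refl)

all-lookup : ∀ {p} {P : List ℕ → Set p} {rs} → All P rs → ∀ j → P (L.lookup rs j)
all-lookup (p ∷ ps) zero = p
all-lookup (p ∷ ps) (suc j) = all-lookup ps j

occs-lookup : ∀ s {N v} rs → All (Shape N v) rs →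
  sum₂ {V = v} (λ j b → 𝟙 (nth (L.lookup rs j) (toℕ b) ≟ s)) ≡ occs s rs
occs-lookup s [] [] = refl
occs-lookup s (r ∷ rs) ((len , _) ∷ shapes) = cong₂ _+_ (occ-nth s r len) (occs-lookup s rs shapes)

shapes⇒array : ∀ {N v₂ K} → Shapes N (2 + v₂) (N C_) K → ∃[ A ] Is11LA {N} {K} {2 + v₂} A
shapes⇒array {N} {v₂} record { list = rs ; shape = shapes ; amount = refl ; occs≤c = occs≤c } =
  realize N (length rs) (λ j b → nth (L.lookup rs j) (toℕ b))
    (λ j → let len , total = all-lookup shapes j in trans (sum-nth (L.lookup rs j) len) total)
    (λ s → subst (_≤ N C s) (sym (occs-lookup s rs shapes)) (occs≤c s))

-- Both sides are the maximum of `m` and `n`.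
m∸n+n≡n∸m+m : ∀ m n → m ∸ n + n ≡ m + (n ∸ m)
m∸n+n≡n∸m+m zero n = 0∸n+n n
  where
  0∸n+n : ∀ n → 0 ∸ n + n ≡ n
  0∸n+n zero = refl
  0∸n+n (suc n) = refl
m∸n+n≡n∸m+m (suc m) zero = refl
m∸n+n≡n∸m+m (suc m) (suc n) = trans (+-suc (m ∸ n) n) (cong suc (m∸n+n≡n∸m+m m n))

-- Columns built around the sets of size below `f`.

module Sizes (N v₂ f′ d : ℕ) (c : ℕ → ℕ)
  (N+d : N + d ≡ suc (suc f′) * (2 + v₂)) (2≤d : 2 ≤ d)
  (absorb : ∀ i → suc i * c (suc i) + i * c i ≡ N * c i)
  (c-mono : ∀ {i s} → i ≤ s → i + s ≤ N → c i ≤ c s)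
  (fv≤1+N : suc f′ * (2 + v₂) ≤ suc N)
  where

  f : ℕ
  f = suc f′

  -- By `absorb` the ratio of consecutive layers is (N - i) / (i + 1), and (i + 1) v ≤ f v ≤ N + 1
  -- makes it at least v - 1.
  c-ratio : ∀ i → i < f → suc v₂ * c i ≤ c (suc i)
  c-ratio i i<f = *-cancelˡ-≤ (suc i) (+-cancelʳ-≤ (i * c i) _ _ (begin
    suc i * (suc v₂ * c i) + i * c i  ≡⟨ lemma i v₂ (c i) ⟩
    (suc i * suc v₂ + i) * c i        ≤⟨ *-monoˡ-≤ (c i) enough ⟩
    N * c i                           ≡⟨ absorb i ⟨
    suc i * c (suc i) + i * c i       ∎))
    where
    open ≤-Reasoning
    lemma : ∀ i v x → suc i * (suc v * x) + i * x ≡ (suc i * suc v + i) * x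
    lemma = solve-∀
    lemma₂ : ∀ i v → suc (suc i * suc v + i) ≡ suc i * (2 + v)
    lemma₂ = solve-∀
    enough : suc i * suc v₂ + i ≤ N
    enough = s≤s⁻¹ (begin
      suc (suc i * suc v₂ + i) ≡⟨ lemma₂ i v₂ ⟩
      suc i * (2 + v₂)         ≤⟨ *-monoˡ-≤ (2 + v₂) i<f ⟩
      f * (2 + v₂)             ≤⟨ fv≤1+N ⟩
      suc N                    ∎)

  -- In the column containing the set of size i, a is the deficit of that set below f + 1,
  -- e the number of sets of size f, and x the excess of one further set above f + 1.
  a e x : ℕ → ℕ
  a i = suc f ∸ i
  e i = d ∸ a i
  x i = a i ∸ d

  -- At most one of `e i` and `x i` is nonzero. If `a i ≤ d`, sets of size f supply the missing
  -- weight; otherwise the larger set offsets the deficit beyond d, and the capped weight of the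
  -- small set is already d.
  row : ℕ → List ℕ
  row i = i ∷ suc f + x i ∷ replicate (e i) f ++ replicate (v₂ ∸ e i) (suc f)

  i+a : ∀ {i} → i ≤ f → i + a i ≡ suc f
  i+a i≤f = m+[n∸m]≡n (m≤n⇒m≤1+n i≤f)

  row-shape : ∀ {i} → i < f → e i ≤ v₂ → Shape N (2 + v₂) (row i)
  row-shape {i} i<f e≤v₂ = cong (2 +_) len , +-cancelʳ-≡ d _ _ (begin
    i + (suc f + x i + List.sum (replicate (e i) f ++ replicate g (suc f))) + d
      ≡⟨ cong (λ z → i + (suc f + x i + z) + d) (trans (sum-++ (replicate (e i) f) _) (cong₂ _+_ (sum-replicate (e i) f) (sum-replicate g (suc f)))) ⟩
    i + (suc f + x i + (e i * f + g * suc f)) + d    ≡⟨ lemma₁ i (suc f) (x i) (e i * f + g * suc f) d ⟩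
    i + suc f + (e i * f + g * suc f) + (x i + d)    ≡⟨ cong (i + suc f + (e i * f + g * suc f) +_) (m∸n+n≡n∸m+m (a i) d) ⟩
    i + suc f + (e i * f + g * suc f) + (a i + e i)  ≡⟨ lemma₂ i f (e i) g (a i) ⟩
    (i + a i) + suc f + (e i + g) * suc f            ≡⟨ cong₂ (λ y z → y + suc f + z * suc f) (i+a (<⇒≤ i<f)) (m+[n∸m]≡n e≤v₂) ⟩
    suc f + suc f + v₂ * suc f                       ≡⟨ lemma₃ (suc f) v₂ ⟩
    suc f * (2 + v₂)                                 ≡⟨ N+d ⟨
    N + d                                            ∎)
    where
    open ≡-Reasoning
    g = v₂ ∸ e i
    len : length (replicate (e i) f ++ replicate g (suc f)) ≡ v₂
    len = trans (length-++ (replicate (e i) f)) (trans (cong₂ _+_ (length-replicate (e i)) (length-replicate g)) (m+[n∸m]≡n e≤v₂))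
    lemma₁ : ∀ i s x r d → i + (s + x + r) + d ≡ i + s + r + (x + d)
    lemma₁ = solve-∀
    lemma₂ : ∀ i f e g a → i + suc f + (e * f + g * suc f) + (a + e) ≡ (i + a) + suc f + (e + g) * suc f
    lemma₂ = solve-∀
    lemma₃ : ∀ s v → s + s + v * s ≡ s * (2 + v)
    lemma₃ = solve-∀

  occ-row : ∀ s i → occ s (row i) ≡ 𝟙 (i ≟ s) + (𝟙 (suc f + x i ≟ s) + (e i * 𝟙 (f ≟ s) + (v₂ ∸ e i) * 𝟙 (suc f ≟ s)))
  occ-row s i = cong (λ z → 𝟙 (i ≟ s) + (𝟙 (suc f + x i ≟ s) + z))
    (trans (occ-++ s (replicate (e i) f) _) (cong₂ _+_ (occ-replicate s (e i) f) (occ-replicate s (v₂ ∸ e i) (suc f))))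

  groups : ℕ → List (List ℕ)
  groups zero = []
  groups (suc n) = groups n ++ replicate (c n) (row n)

  groups-shape : ∀ n → n ≤ f → (∀ i → i < n → e i ≤ v₂) → All (Shape N (2 + v₂)) (groups n)
  groups-shape zero _ _ = []
  groups-shape (suc n) n<f e≤ = AllP.++⁺ (groups-shape n (<⇒≤ n<f) (λ i i<n → e≤ i (m≤n⇒m≤1+n i<n)))
                                         (AllP.replicate⁺ (c n) (row-shape n<f (e≤ n ≤-refl)))

  groups-length : ∀ n → length (groups n) ≡ ∑< n c
  groups-length zero = refl
  groups-length (suc n) = trans (length-++ (groups n)) (trans (cong₂ _+_ (groups-length n) (length-replicate (c n))) (sym (∑<-suc n c)))

  groups-occs : ∀ s n → occs s (groups n) ≡ ∑< n (λ i → c i * occ s (row i))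
  groups-occs s zero = refl
  groups-occs s (suc n) = trans (occs-++ s (groups n) _)
    (trans (cong₂ _+_ (groups-occs s n) (occs-replicate s (c n) (row n))) (sym (∑<-suc n (λ i → c i * occ s (row i)))))

  occ-small : ∀ {s} i → s < f → occ s (row i) ≡ 𝟙 (i ≟ s)
  occ-small {s} i s<f = begin
    occ s (row i) ≡⟨ occ-row s i ⟩
    𝟙 (i ≟ s) + (𝟙 (suc f + x i ≟ s) + (e i * 𝟙 (f ≟ s) + (v₂ ∸ e i) * 𝟙 (suc f ≟ s)))
      ≡⟨ cong (𝟙 (i ≟ s) +_) (cong₂ _+_ (𝟙-no (suc f + x i ≟ s) (λ q → <-irrefl (sym q) (≤-trans s<f (≤-trans (n≤1+n f) (m≤m+n (suc f) (x i))))))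
           (cong₂ _+_ (trans (cong (e i *_) (𝟙-no (f ≟ s) (λ q → <-irrefl (sym q) s<f))) (*-zeroʳ (e i)))
                      (trans (cong ((v₂ ∸ e i) *_) (𝟙-no (suc f ≟ s) (λ q → <-irrefl (sym q) (m≤n⇒m≤1+n s<f)))) (*-zeroʳ (v₂ ∸ e i))))) ⟩
    𝟙 (i ≟ s) + 0 ≡⟨ +-identityʳ _ ⟩
    𝟙 (i ≟ s) ∎
    where open ≡-Reasoning

  occ-f : ∀ i → i < f → occ f (row i) ≡ e i
  occ-f i i<f = begin
    occ f (row i) ≡⟨ occ-row f i ⟩
    𝟙 (i ≟ f) + (𝟙 (suc f + x i ≟ f) + (e i * 𝟙 (f ≟ f) + (v₂ ∸ e i) * 𝟙 (suc f ≟ f)))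
      ≡⟨ cong₂ _+_ (𝟙-no (i ≟ f) (λ q → <-irrefl q i<f)) (cong₂ _+_ (𝟙-no (suc f + x i ≟ f) (λ q → <-irrefl (sym q) (m≤m+n (suc f) (x i))))
           (cong₂ _+_ (trans (cong (e i *_) (𝟙-yes (f ≟ f) refl)) (*-identityʳ (e i)))
                      (trans (cong ((v₂ ∸ e i) *_) (𝟙-no (suc f ≟ f) (λ q → <-irrefl (sym q) ≤-refl))) (*-zeroʳ (v₂ ∸ e i))))) ⟩
    e i + 0 ≡⟨ +-identityʳ _ ⟩
    e i ∎
    where open ≡-Reasoning

  y : ℕ → ℕ
  y i = 𝟙 (x i ≟ 0) + (v₂ ∸ e i)

  occ-1+f : ∀ i → i < f → occ (suc f) (row i) ≡ y i
  occ-1+f i i<f = begin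
    occ (suc f) (row i) ≡⟨ occ-row (suc f) i ⟩
    𝟙 (i ≟ suc f) + (𝟙 (suc f + x i ≟ suc f) + (e i * 𝟙 (f ≟ suc f) + (v₂ ∸ e i) * 𝟙 (suc f ≟ suc f)))
      ≡⟨ cong₂ _+_ (𝟙-no (i ≟ suc f) (λ q → <-irrefl q (m≤n⇒m≤1+n i<f)))
           (cong₂ _+_ (𝟙-cong (suc f + x i ≟ suc f) (x i ≟ 0) (λ q → +-cancelˡ-≡ (suc f) _ _ (trans q (sym (+-identityʳ _)))) (λ q → trans (cong (suc f +_) q) (+-identityʳ _)))
           (cong₂ _+_ (trans (cong (e i *_) (𝟙-no (f ≟ suc f) (λ q → <-irrefl q ≤-refl))) (*-zeroʳ (e i)))
                      (trans (cong ((v₂ ∸ e i) *_) (𝟙-yes (suc f ≟ suc f) refl)) (*-identityʳ (v₂ ∸ e i))))) ⟩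
    y i ∎
    where open ≡-Reasoning

  occ-large : ∀ i k → i < f → occ (suc f + suc k) (row i) ≡ 𝟙 (x i ≟ suc k)
  occ-large i k i<f = begin
    occ s (row i) ≡⟨ occ-row s i ⟩
    𝟙 (i ≟ s) + (𝟙 (suc f + x i ≟ s) + (e i * 𝟙 (f ≟ s) + (v₂ ∸ e i) * 𝟙 (suc f ≟ s)))
      ≡⟨ cong₂ _+_ (𝟙-no (i ≟ s) (λ q → <-irrefl q (<-trans i<f f<s)))
           (cong₂ _+_ (𝟙-cong (suc f + x i ≟ s) (x i ≟ suc k) (+-cancelˡ-≡ (suc f) _ _) (cong (suc f +_)))
           (cong₂ _+_ (trans (cong (e i *_) (𝟙-no (f ≟ s) (λ q → <-irrefl q f<s))) (*-zeroʳ (e i)))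
                      (trans (cong ((v₂ ∸ e i) *_) (𝟙-no (suc f ≟ s) (λ q → <-irrefl q 1+f<s))) (*-zeroʳ (v₂ ∸ e i))))) ⟩
    𝟙 (x i ≟ suc k) + 0 ≡⟨ +-identityʳ _ ⟩
    𝟙 (x i ≟ suc k) ∎
    where
    open ≡-Reasoning
    s = suc f + suc k
    1+f<s : suc f < s
    1+f<s = m<m+n (suc f) (s≤s z≤n)
    f<s : f < s
    f<s = <⇒≤ 1+f<s

  groups-small : ∀ {s} n → s < f → occs s (groups n) ≤ c s
  groups-small {s} n s<f = subst (_≤ c s) (sym (groups-occs s n)) (∑<-lone n _ (c s) bound unique)
    where
    hit : ∀ i → 0 < c i * occ s (row i) → i ≡ s
    hit i p = 𝟙>0 (i ≟ s) (n≢0⇒n>0 λ z → <-irrefl (sym (trans (cong (c i *_) (trans (occ-small i s<f) z)) (*-zeroʳ (c i)))) p)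
    bound : ∀ i → i < n → 0 < c i * occ s (row i) → c i * occ s (row i) ≤ c s
    bound i _ p with hit i p
    ... | refl = subst (_≤ c s) (sym (trans (cong (c s *_) (trans (occ-small s s<f) (𝟙-yes (s ≟ s) refl))) (*-identityʳ (c s)))) ≤-refl
    unique : ∀ i j → i < n → j < n → 0 < c i * occ s (row i) → 0 < c j * occ s (row j) → i ≡ j
    unique i j _ _ p q = trans (hit i p) (sym (hit j q))

  groups-absent : ∀ {s} n → n ≤ s → s < f → occs s (groups n) ≡ 0
  groups-absent {s} n n≤s s<f = trans (groups-occs s n) (∑<-zero n λ i i<n →
    trans (cong (c i *_) (trans (occ-small i s<f) (𝟙-no (i ≟ s) λ q → <-irrefl q (<-≤-trans i<n n≤s)))) (*-zeroʳ (c i)))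

  groups-f : ∀ n → n ≤ f → occs f (groups n) ≡ ∑< n (λ i → c i * e i)
  groups-f n n≤f = trans (groups-occs f n) (∑<-cong n λ i i<n → cong (c i *_) (occ-f i (<-≤-trans i<n n≤f)))

  groups-1+f : ∀ n → n ≤ f → occs (suc f) (groups n) ≡ ∑< n (λ i → c i * y i)
  groups-1+f n n≤f = trans (groups-occs (suc f) n) (∑<-cong n λ i i<n → cong (c i *_) (occ-1+f i (<-≤-trans i<n n≤f)))

  -- Only one i has deficit d + k, and i + (f + 1 + k) ≤ N lets monotonicity compare the two layers.
  -- Exactness is an assumption because truncation gives `x i ≡ 0` for every deficit up to d.
  excess-bound : ∀ n k → n ≤ f → (∀ i → i < n → x i ≡ k → a i ≡ d + k) →
    ∑< n (λ i → c i * 𝟙 (x i ≟ k)) ≤ c (suc f + k)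
  excess-bound n k n≤f exact = ∑<-lone n _ (c (suc f + k)) bound unique
    where
    hit : ∀ i → 0 < c i * 𝟙 (x i ≟ k) → x i ≡ k
    hit i p = 𝟙>0 (x i ≟ k) (n≢0⇒n>0 λ z → <-irrefl (sym (trans (cong (c i *_) z) (*-zeroʳ (c i)))) p)
    i+d+k : ∀ i → i < n → 0 < c i * 𝟙 (x i ≟ k) → i + (d + k) ≡ suc f
    i+d+k i i<n p = trans (cong (i +_) (sym (exact i i<n (hit i p)))) (i+a (<⇒≤ (<-≤-trans i<n n≤f)))
    bound : ∀ i → i < n → 0 < c i * 𝟙 (x i ≟ k) → c i * 𝟙 (x i ≟ k) ≤ c (suc f + k)
    bound i i<n p = begin
      c i * 𝟙 (x i ≟ k) ≤⟨ *-monoʳ-≤ (c i) (𝟙≤1 (x i ≟ k)) ⟩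
      c i * 1           ≡⟨ *-identityʳ (c i) ⟩
      c i               ≤⟨ c-mono (≤-trans (<⇒≤ (<-≤-trans i<n n≤f)) (≤-trans (n≤1+n f) (m≤m+n (suc f) k))) room ⟩
      c (suc f + k)     ∎
      where
      open ≤-Reasoning
      shuffle : ∀ i s k d → i + (s + k) + d ≡ s + (i + (d + k))
      shuffle = solve-∀
      double : ∀ s v → s + s + v * s ≡ s * (2 + v)
      double = solve-∀
      room : i + (suc f + k) ≤ N
      room = +-cancelʳ-≤ d _ _ (begin
        i + (suc f + k) + d   ≡⟨ shuffle i (suc f) k d ⟩
        suc f + (i + (d + k)) ≡⟨ cong (suc f +_) (i+d+k i i<n p) ⟩
        suc f + suc f         ≤⟨ m≤m+n _ (v₂ * suc f) ⟩
        suc f + suc f + v₂ * suc f ≡⟨ double (suc f) v₂ ⟩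
        suc f * (2 + v₂)      ≡⟨ N+d ⟨
        N + d                 ∎)
    unique : ∀ i j → i < n → j < n → 0 < c i * 𝟙 (x i ≟ k) → 0 < c j * 𝟙 (x j ≟ k) → i ≡ j
    unique i j i<n j<n p q = +-cancelʳ-≡ (d + k) i j (trans (i+d+k i i<n p) (sym (i+d+k j j<n q)))

  groups-large : ∀ n k → n ≤ f → occs (suc f + suc k) (groups n) ≤ c (suc f + suc k)
  groups-large n k n≤f = subst (_≤ c (suc f + suc k))
    (sym (trans (groups-occs _ n) (∑<-cong n λ i i<n → cong (c i *_) (occ-large i k (<-≤-trans i<n n≤f)))))
    (excess-bound n (suc k) n≤f λ i _ q → trans (sym (m+[n∸m]≡n (<⇒≤ (x-pos i q)))) (cong (d +_) q))
    where
    x-pos : ∀ i → x i ≡ suc k → d < a i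
    x-pos i q = m∸n≢0⇒n<m λ z → 0≢1+n (trans (sym z) q)

  -- Geometric growth: `c n` covers all earlier columns and (v - 2) `c n` the new ones, together at
  -- most `c (suc n)`.
  e-sum : ∀ n → n ≤ f → (∀ i → i < n → e i ≤ v₂) → ∑< n (λ i → c i * e i) ≤ c n
  e-sum zero _ _ = z≤n
  e-sum (suc n) n<f e≤ = begin
    ∑< (suc n) (λ i → c i * e i)         ≡⟨ ∑<-suc n (λ i → c i * e i) ⟩
    ∑< n (λ i → c i * e i) + c n * e n   ≤⟨ +-mono-≤ (e-sum n (<⇒≤ n<f) (λ i i<n → e≤ i (m≤n⇒m≤1+n i<n))) (*-monoʳ-≤ (c n) (e≤ n ≤-refl)) ⟩
    c n + c n * v₂                       ≡⟨ cong (c n +_) (*-comm (c n) v₂) ⟩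
    suc v₂ * c n                         ≤⟨ c-ratio n n<f ⟩
    c (suc n)                            ∎
    where open ≤-Reasoning

  y≤ : ∀ i → y i ≤ suc v₂
  y≤ i = +-mono-≤ (𝟙≤1 (x i ≟ 0)) (m∸n≤m v₂ (e i))

  Y : ℕ → ℕ
  Y n = ∑< n (λ i → c i * y i)

  Y-suc : ∀ n → Y (suc n) ≡ Y n + c n * y n
  Y-suc n = ∑<-suc n (λ i → c i * y i)

  -- Geometric growth: Y n ≤ κ c n is inherited whenever κ + y n ≤ κ (v - 1).
  Y≤ : ∀ κ n → n ≤ f → (∀ i → i < n → κ + y i ≤ κ * suc v₂) → Y n ≤ κ * c n
  Y≤ κ zero _ _ = z≤n
  Y≤ κ (suc n) n<f small = begin
    Y (suc n)             ≡⟨ Y-suc n ⟩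
    Y n + c n * y n       ≤⟨ +-monoˡ-≤ _ (Y≤ κ n (<⇒≤ n<f) (λ i i<n → small i (m≤n⇒m≤1+n i<n))) ⟩
    κ * c n + c n * y n   ≡⟨ cong (κ * c n +_) (*-comm (c n) (y n)) ⟩
    κ * c n + y n * c n   ≡⟨ *-distribʳ-+ (c n) κ (y n) ⟨
    (κ + y n) * c n       ≤⟨ *-monoˡ-≤ (c n) (small n ≤-refl) ⟩
    κ * suc v₂ * c n      ≡⟨ *-assoc κ (suc v₂) (c n) ⟩
    κ * (suc v₂ * c n)    ≤⟨ *-monoʳ-≤ κ (c-ratio n n<f) ⟩
    κ * c (suc n)         ∎
    where open ≤-Reasoning

  -- As `y i` is at most v - 1, the growth condition for κ = 2 amounts to v ≥ 3.
  Y≤2 : 1 ≤ v₂ → ∀ n → n ≤ f → Y n ≤ 2 * c n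
  Y≤2 1≤v₂ n n≤f = Y≤ 2 n n≤f λ i _ → begin
    2 + y i          ≤⟨ +-monoʳ-≤ 2 (y≤ i) ⟩
    2 + suc v₂       ≡⟨ cong (λ z → 2 + z) (+-comm 1 v₂) ⟩
    2 + (v₂ + 1)     ≤⟨ +-monoʳ-≤ 2 (+-monoʳ-≤ v₂ 1≤v₂) ⟩
    2 + (v₂ + v₂)    ≡⟨ double v₂ ⟩
    2 * suc v₂       ∎
    where
    open ≤-Reasoning
    double : ∀ v → 2 + (v + v) ≡ 2 * suc v
    double = solve-∀

  -- For v = 2 the growth factor is only 1, but a column then has just two sets, and size f + 1 can
  -- be paired only with size f + 1 - d.
  Y-binary : v₂ ≡ 0 → ∀ n → n ≤ f → (∀ i → i < n → e i ≤ v₂) → Y n ≤ c (suc f)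
  Y-binary refl n n≤f e≤ = begin
    Y n                              ≡⟨ ∑<-cong n (λ i _ → cong (c i *_) (trans (cong (𝟙 (x i ≟ 0) +_) (0∸n≡0 (d ∸ a i))) (+-identityʳ _))) ⟩
    ∑< n (λ i → c i * 𝟙 (x i ≟ 0))   ≤⟨ excess-bound n 0 n≤f exact ⟩
    c (suc f + 0)                    ≡⟨ cong c (+-identityʳ (suc f)) ⟩
    c (suc f)                        ∎
    where
    open ≤-Reasoning
    exact : ∀ i → i < n → x i ≡ 0 → a i ≡ d + 0
    exact i i<n q = trans (≤-antisym (m∸n≡0⇒m≤n q) (m∸n≡0⇒m≤n (n≤0⇒n≡0 (e≤ i i<n)))) (sym (+-identityʳ d))

  weights : ℕ
  weights = ∑< (suc f) (λ i → c i * weight f d i)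

  -- Each column is worth d: its small set carries `weight f d i`, its sets of size f the other
  -- `e i`.
  weights-split : ∀ n → ∑< n (λ i → c i * weight f d i) + ∑< n (λ i → c i * e i) ≡ ∑< n c * d
  weights-split n = begin
    ∑< n (λ i → c i * weight f d i) + ∑< n (λ i → c i * e i) ≡⟨ ∑-distrib-+ {n} (λ i → c (toℕ i) * weight f d (toℕ i)) _ ⟨
    ∑< n (λ i → c i * weight f d i + c i * e i)              ≡⟨ ∑<-cong n (λ i _ → at i) ⟩
    ∑< n (λ i → c i * d)                                     ≡⟨ *-distribʳ-sum {n} d (c ∘ toℕ) ⟨
    ∑< n c * d                                               ∎
    where
    open ≡-Reasoning
    at : ∀ i → c i * weight f d i + c i * e i ≡ c i * d
    at i = trans (sym (*-distribˡ-+ (c i) (weight f d i) (e i)))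
      (cong (c i *_) (trans (cong (_+ e i) (⊓-comm d (a i))) (m⊓n+n∸m≡n (a i) d)))

-- Arithmetic of neighbouring layers and of the last columns.

excess-arith : ∀ g e t → 1 ≤ e + t → (2 + e) * (2 + g) ≤ (1 + e) * suc (suc g * (1 + e) + (2 + g) * t)
excess-arith g zero (suc u) _ = ≤-trans (m≤m+n _ ((2 + g) * u)) (≤-reflexive (identity g u))
  where
  identity : ∀ g u → 2 * (2 + g) + (2 + g) * u ≡ 1 * suc (suc g * 1 + (2 + g) * suc u)
  identity = solve-∀
excess-arith g (suc e) t _ = ≤-trans (m≤m+n _ (e * e + 3 * e + g * (e * e + 3 * e + 1) + (2 + e) * (2 + g) * t)) (≤-reflexive (identity g e t))
  where
  identity : ∀ g e t → (3 + e) * (2 + g) + (e * e + 3 * e + g * (e * e + 3 * e + 1) + (2 + e) * (2 + g) * t)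
                     ≡ (2 + e) * suc (suc g * (2 + e) + (2 + g) * t)
  identity = solve-∀

-- Here d = 2 + e, v = d + t, N = f d + (f + 1) t and l = N - f. After multiplication by f (f + 1),
-- the bounds f v ≤ N and d (f + 1) ≤ (d - 1)(l + 1) turn the first term into a multiple of `c₁`,
-- and (d - 1) N + t (f + 1) = d l closes the estimate. The second bound is `excess-arith`, which
-- fails for e = t = 0, that is for v = 2.
middle-layer : ∀ g e t c₀ c₁ c₂ → 1 ≤ e + t → let f = suc g ; l = f * (1 + e) + suc f * t in
  suc f * c₂ ≡ l * c₁ → f * c₁ ≡ suc l * c₀ →
  (2 + e) * ((2 + (e + t)) * c₀) + t * c₁ ≤ (2 + e) * c₂
middle-layer g e t c₀ c₁ c₂ 1≤ eq₂ eq₁ = *-cancelˡ-≤ (f * suc f) (begin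
  f * suc f * ((2 + e) * ((2 + (e + t)) * c₀) + t * c₁)
    ≡⟨ shape₁ g e t c₀ c₁ ⟩
  (2 + e) * suc f * (f * (2 + (e + t)) * c₀) + t * c₁ * (f * suc f)
    ≤⟨ +-monoˡ-≤ _ (*-mono-≤ (excess-arith g e t 1≤) (*-monoˡ-≤ c₀ (≤-trans (m≤m+n _ t) (≤-reflexive (shape₂ g e t))))) ⟩
  (1 + e) * suc l * (N * c₀) + t * c₁ * (f * suc f)
    ≡⟨ cong (_+ t * c₁ * (f * suc f)) (shape₃ e (suc l) N c₀) ⟩
  (1 + e) * N * (suc l * c₀) + t * c₁ * (f * suc f)
    ≡⟨ cong (λ z → (1 + e) * N * z + t * c₁ * (f * suc f)) eq₁ ⟨
  (1 + e) * N * (f * c₁) + t * c₁ * (f * suc f)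
    ≡⟨ shape₄ g e t c₁ ⟩
  (2 + e) * f * (l * c₁)
    ≡⟨ cong ((2 + e) * f *_) eq₂ ⟨
  (2 + e) * f * (suc f * c₂)
    ≡⟨ shape₅ e f (suc f) c₂ ⟩
  f * suc f * ((2 + e) * c₂) ∎)
  where
  open ≤-Reasoning
  f = suc g
  l = f * (1 + e) + suc f * t
  N = f * (2 + e) + suc f * t
  shape₁ : ∀ g e t x z → suc g * suc (suc g) * ((2 + e) * ((2 + (e + t)) * x) + t * z)
         ≡ (2 + e) * suc (suc g) * (suc g * (2 + (e + t)) * x) + t * z * (suc g * suc (suc g))
  shape₁ = solve-∀
  shape₂ : ∀ g e t → suc g * (2 + (e + t)) + t ≡ suc g * (2 + e) + suc (suc g) * t
  shape₂ = solve-∀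
  shape₃ : ∀ e m n x → (1 + e) * m * (n * x) ≡ (1 + e) * n * (m * x)
  shape₃ = solve-∀
  shape₄ : ∀ g e t z → (1 + e) * (suc g * (2 + e) + suc (suc g) * t) * (suc g * z) + t * z * (suc g * suc (suc g))
         ≡ (2 + e) * suc g * ((suc g * (1 + e) + suc (suc g) * t) * z)
  shape₄ = solve-∀
  shape₅ : ∀ e f h x → (2 + e) * f * (h * x) ≡ f * h * ((2 + e) * x)
  shape₅ = solve-∀

-- When d = v + 1, the last B columns have room for only v sets of size f, so each takes a set
-- of size f - 1 (deficit two); p of them take one and q take two.
split-pairs : ∀ v₂ n₁ n₂ P → n₁ ≡ suc v₂ * n₂ → P ≤ n₂ → (v₂ ≡ 0 → P ≡ 0) →
  ∀ B → B * (3 + v₂) ≤ (n₁ ∸ P) + 2 * n₂ →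
  ∃[ p ] ∃[ q ] (p + q ≡ B × p + (q + q) ≤ n₂ × q + q ≤ n₂ × P + (p * suc v₂ + q * (v₂ ∸ 1)) ≤ n₁ × (q ≡ 0 ⊎ 1 ≤ v₂))
split-pairs v₂ _ n₂ P refl P≤n₂ P≡0 B le = go v₂ P≡0 le
  where
  open ≤-Reasoning
  three : ∀ v n → suc v * n + 2 * n ≡ n * (3 + v)
  three = solve-∀
  B≤n₂ : B ≤ n₂
  B≤n₂ = *-cancelʳ-≤ B n₂ (3 + v₂) (begin
    B * (3 + v₂)                      ≤⟨ le ⟩
    (suc v₂ * n₂ ∸ P) + 2 * n₂        ≤⟨ +-monoˡ-≤ (2 * n₂) (m∸n≤m _ P) ⟩
    suc v₂ * n₂ + 2 * n₂              ≡⟨ three v₂ n₂ ⟩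
    n₂ * (3 + v₂)                     ∎)
  go : ∀ v₂ → (v₂ ≡ 0 → P ≡ 0) → B * (3 + v₂) ≤ (suc v₂ * n₂ ∸ P) + 2 * n₂ →
    ∃[ p ] ∃[ q ] (p + q ≡ B × p + (q + q) ≤ n₂ × q + q ≤ n₂ × P + (p * suc v₂ + q * (v₂ ∸ 1)) ≤ suc v₂ * n₂ × (q ≡ 0 ⊎ 1 ≤ v₂))
  go zero P≡0 le = B , 0 , +-identityʳ B , ≤-trans (≤-reflexive (+-identityʳ B)) B≤n₂ , z≤n ,
    subst₂ _≤_ (sym (trans (cong (_+ (B * 1 + 0)) (P≡0 refl)) (trans (+-identityʳ _) (*-identityʳ B)))) (sym (*-identityˡ n₂)) B≤n₂ , inj₁ refl
  go (suc w) _ le with ≤-total n₂ (B + B)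
  ... | inj₂ 2B≤n₂ = 0 , B , refl , 2B≤n₂ , 2B≤n₂ , (begin
      P + B * w             ≤⟨ +-mono-≤ P≤n₂ (*-monoˡ-≤ w B≤n₂) ⟩
      n₂ + n₂ * w           ≤⟨ m≤m+n _ n₂ ⟩
      n₂ + n₂ * w + n₂      ≡⟨ shape w n₂ ⟩
      suc (suc w) * n₂      ∎) , inj₂ (s≤s z≤n)
    where
    shape : ∀ w n → n + n * w + n ≡ suc (suc w) * n
    shape = solve-∀
  -- The sets of size f - 1 are used up: p + 2 q = n₂. Every column weighs v + 1, so subtracting
  -- their weight 2 n₂ from both sides of `le` leaves the bound for the sets of size f.
  ... | inj₁ n₂≤2B = p , q , p+q≡B , ≤-reflexive p+2q≡n₂ , ≤-trans (m≤n+m (q + q) p) (≤-reflexive p+2q≡n₂) , ones , inj₂ (s≤s z≤n)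
    where
    q = n₂ ∸ B
    p = B ∸ q
    B+q≡n₂ : B + q ≡ n₂
    B+q≡n₂ = m+[n∸m]≡n B≤n₂
    p+q≡B : p + q ≡ B
    p+q≡B = m∸n+n≡m (+-cancelˡ-≤ B q B (≤-trans (≤-reflexive B+q≡n₂) n₂≤2B))
    p+2q≡n₂ : p + (q + q) ≡ n₂
    p+2q≡n₂ = trans (sym (+-assoc p q q)) (trans (cong (_+ q) p+q≡B) B+q≡n₂)
    shape : ∀ P p q w → P + (p * suc (suc w) + q * w) + 2 * (p + (q + q)) ≡ P + (p + q) * (3 + suc w)
    shape = solve-∀
    P≤n₁ : P ≤ suc (suc w) * n₂
    P≤n₁ = ≤-trans P≤n₂ (m≤m+n n₂ _)
    ones : P + (p * suc (suc w) + q * w) ≤ suc (suc w) * n₂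
    ones = +-cancelʳ-≤ (2 * n₂) _ _ (begin
      P + (p * suc (suc w) + q * w) + 2 * n₂            ≡⟨ cong (λ z → P + (p * suc (suc w) + q * w) + 2 * z) p+2q≡n₂ ⟨
      P + (p * suc (suc w) + q * w) + 2 * (p + (q + q)) ≡⟨ shape P p q w ⟩
      P + (p + q) * (3 + suc w)                         ≡⟨ cong (λ z → P + z * (3 + suc w)) p+q≡B ⟩
      P + B * (3 + suc w)                               ≤⟨ +-monoʳ-≤ P le ⟩
      P + ((suc (suc w) * n₂ ∸ P) + 2 * n₂)             ≡⟨ +-assoc P _ _ ⟨
      P + (suc (suc w) * n₂ ∸ P) + 2 * n₂               ≡⟨ cong (_+ 2 * n₂) (m+[n∸m]≡n P≤n₁) ⟩
      suc (suc w) * n₂ + 2 * n₂                         ∎)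

[q*d+r]/d : ∀ q r d .{{_ : NonZero d}} → (q * d + r) / d ≡ q + r / d
[q*d+r]/d q r d = trans (+-distrib-/-∣ˡ r (divides q refl)) (cong (_+ r / d) (m*n/n≡m q d))

n≡0⊎n>0 : ∀ n → n ≡ 0 ⊎ 0 < n
n≡0⊎n>0 zero = inj₁ refl
n≡0⊎n>0 (suc n) = inj₂ (s≤s z≤n)

data Region (f : ℕ) : ℕ → Set where
  below  : ∀ {s} → s < f → Region f s
  middle : Region f f
  next   : Region f (suc f)
  above  : ∀ k → Region f (suc f + suc k)

region : ∀ f s → Region f s
region f s with <-cmp s f
... | tri< s<f _ _ = below s<f
... | tri≈ _ refl _ = middle
... | tri> _ _ f<s with m≤n⇒∃[o]m+o≡n f<s
...   | zero , refl = subst (Region f) (cong suc (sym (+-identityʳ f))) next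
...   | suc k , refl = above k

-- The full list of columns, for d ≤ v and for d = v + 1.

module Construction (N v₂ f′ d : ℕ) (c : ℕ → ℕ)
  (N+d : N + d ≡ suc (suc f′) * (2 + v₂)) (2≤d : 2 ≤ d)
  (absorb : ∀ i → suc i * c (suc i) + i * c i ≡ N * c i)
  (c-mono : ∀ {i s} → i ≤ s → i + s ≤ N → c i ≤ c s)
  (fv≤1+N : suc f′ * (2 + v₂) ≤ suc N)
  where

  open Sizes N v₂ f′ d c N+d 2≤d absorb c-mono fv≤1+N
  open ≤-Reasoning

  instance
    d≢0 : NonZero d
    d≢0 = >-nonZero (≤-trans (s≤s z≤n) 2≤d)

  deficit≥2 : ∀ {i} → i < f → 2 ≤ a i
  deficit≥2 i<f = m+n≤o⇒m≤o∸n 2 (s≤s i<f)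

  a-f : a f ≡ 1
  a-f = m+n∸n≡m 1 f

  a-f′ : a f′ ≡ 2
  a-f′ = m+n∸n≡m 2 f′

  d⊓1≡1 : d ⊓ 1 ≡ 1
  d⊓1≡1 = m≥n⇒m⊓n≡n (≤-trans (s≤s z≤n) 2≤d)

  module Ordinary (d≤v : d ≤ 2 + v₂) where

    t B P : ℕ
    t = 2 + v₂ ∸ d
    P = ∑< f (λ i → c i * e i)
    B = (c f ∸ P) / d

    e≤v₂ : ∀ i → i < f → e i ≤ v₂
    e≤v₂ i i<f = ≤-trans (∸-monoʳ-≤ d (deficit≥2 i<f)) (∸-monoˡ-≤ 2 d≤v)

    P≤ : P ≤ c f
    P≤ = e-sum f ≤-refl e≤v₂

    Bd≤ : B * d ≤ c f ∸ P
    Bd≤ = m/n*n≤m (c f ∸ P) d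

    rest : List ℕ
    rest = replicate d f ++ replicate t (suc f)

    rest-shape : Shape N (2 + v₂) rest
    rest-shape = trans (length-++ (replicate d f)) (trans (cong₂ _+_ (length-replicate d) (length-replicate t)) (m+[n∸m]≡n d≤v)) ,
      +-cancelʳ-≡ d _ _ (begin-equality
        List.sum rest + d          ≡⟨ cong (_+ d) (trans (sum-++ (replicate d f) _) (cong₂ _+_ (sum-replicate d f) (sum-replicate t (suc f)))) ⟩
        d * f + t * suc f + d      ≡⟨ shape d f t ⟩
        suc f * (d + t)            ≡⟨ cong (suc f *_) (m+[n∸m]≡n d≤v) ⟩
        suc f * (2 + v₂)           ≡⟨ N+d ⟨
        N + d                      ∎)
      where
      shape : ∀ d f t → d * f + t * suc f + d ≡ suc f * (d + t)
      shape = solve-∀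

    occ-rest : ∀ s → occ s rest ≡ d * 𝟙 (f ≟ s) + t * 𝟙 (suc f ≟ s)
    occ-rest s = trans (occ-++ s (replicate d f) _) (cong₂ _+_ (occ-replicate s d f) (occ-replicate s t (suc f)))

    list : List (List ℕ)
    list = groups f ++ replicate B rest

    occs-list : ∀ s → occs s list ≡ occs s (groups f) + B * (d * 𝟙 (f ≟ s) + t * 𝟙 (suc f ≟ s))
    occs-list s = trans (occs-++ s (groups f) _) (cong (occs s (groups f) +_) (trans (occs-replicate s B rest) (cong (B *_) (occ-rest s))))

    amount : length list ≡ weights / d
    amount = begin-equality
      length list                        ≡⟨ trans (length-++ (groups f)) (cong₂ _+_ (groups-length f) (length-replicate B)) ⟩
      ∑< f c + (c f ∸ P) / d             ≡⟨ [q*d+r]/d (∑< f c) (c f ∸ P) d ⟨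
      (∑< f c * d + (c f ∸ P)) / d       ≡⟨ cong (_/ d) (+-cancelʳ-≡ P _ _ balance) ⟨
      weights / d                        ∎
      where
      W = ∑< f (λ i → c i * weight f d i)
      shuffle : ∀ w x p → w + x + p ≡ w + p + x
      shuffle = solve-∀
      balance : weights + P ≡ ∑< f c * d + (c f ∸ P) + P
      balance = begin-equality
        weights + P                     ≡⟨ cong (_+ P) (∑<-suc f (λ i → c i * weight f d i)) ⟩
        W + c f * (d ⊓ a f) + P         ≡⟨ cong (λ z → W + z + P) (trans (cong (c f *_) (trans (cong (d ⊓_) a-f) d⊓1≡1)) (*-identityʳ (c f))) ⟩
        W + c f + P                     ≡⟨ shuffle W (c f) P ⟩
        W + P + c f                     ≡⟨ cong₂ _+_ (weights-split f) (sym (m∸n+n≡m P≤)) ⟩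
        ∑< f c * d + (c f ∸ P + P)      ≡⟨ +-assoc (∑< f c * d) _ P ⟨
        ∑< f c * d + (c f ∸ P) + P      ∎

    -- The factor κ for the earlier groups and the bound on `y f′` must add up to v. If d = 2, the
    -- earlier groups have positive excess, so κ = 1 suffices beside v - 1; if d ≥ 3, the last group
    -- contains a set of size f, so κ = 2 goes with v - 2.
    Y≤v : 1 ≤ v₂ → Y f ≤ (2 + v₂) * c f′
    Y≤v 1≤v₂ with m≤n⇒m<n∨m≡n 2≤d
    ... | inj₂ refl = begin
        Y f                     ≡⟨ Y-suc f′ ⟩
        Y f′ + c f′ * y f′      ≤⟨ +-mono-≤ (Y≤ 1 f′ (n≤1+n f′) early) (*-monoʳ-≤ (c f′) (y≤ f′)) ⟩
        1 * c f′ + c f′ * suc v₂ ≡⟨ shape (c f′) v₂ ⟩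
        (2 + v₂) * c f′         ∎
      where
      shape : ∀ z v → 1 * z + z * suc v ≡ (2 + v) * z
      shape = solve-∀
      early : ∀ i → i < f′ → 1 + y i ≤ 1 * suc v₂
      early i i<f′ = ≤-trans (s≤s (≤-trans (≤-reflexive (cong (_+ (v₂ ∸ e i)) (𝟙-no (x i ≟ 0) excess))) (m∸n≤m v₂ (e i)))) (≤-reflexive (sym (*-identityˡ (suc v₂))))
        where
        excess : ¬ x i ≡ 0
        excess q = <-irrefl refl (≤-trans (m+n≤o⇒m≤o∸n 3 (s≤s (s≤s i<f′))) (m∸n≡0⇒m≤n q))
    ... | inj₁ 3≤d = begin
        Y f                     ≡⟨ Y-suc f′ ⟩
        Y f′ + c f′ * y f′      ≤⟨ +-mono-≤ (Y≤2 1≤v₂ f′ (n≤1+n f′)) (*-monoʳ-≤ (c f′) last) ⟩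
        2 * c f′ + c f′ * v₂    ≡⟨ shape (c f′) v₂ ⟩
        (2 + v₂) * c f′         ∎
      where
      shape : ∀ z v → 2 * z + z * v ≡ (2 + v) * z
      shape = solve-∀
      1≤e : 1 ≤ e f′
      1≤e = subst (λ z → 1 ≤ d ∸ z) (sym a-f′) (∸-monoˡ-≤ 2 3≤d)
      last : y f′ ≤ v₂
      last = ≤-trans (+-mono-≤ (𝟙≤1 (x f′ ≟ 0)) (∸-monoʳ-≤ v₂ 1≤e)) (≤-reflexive (m+[n∸m]≡n 1≤v₂))

    -- Multiplied by d, the count `B` is controlled by `B * d ≤ c f`, and the claim becomes
    -- `middle-layer`.
    layer : 1 ≤ v₂ → Y f + B * t ≤ c (suc f)
    layer 1≤v₂ with m≤n⇒∃[o]m+o≡n 2≤d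
    ... | e₀ , refl = *-cancelˡ-≤ d (begin
      d * (Y f + B * t)                  ≡⟨ shape d (Y f) B t ⟩
      d * Y f + t * (B * d)              ≤⟨ +-mono-≤ (*-monoʳ-≤ d (Y≤v 1≤v₂)) (*-monoʳ-≤ t (≤-trans Bd≤ (m∸n≤m (c f) P))) ⟩
      d * ((2 + v₂) * c f′) + t * c f    ≡⟨ cong (λ z → d * ((2 + z) * c f′) + t * c f) v₂≡ ⟨
      d * ((2 + (e₀ + t)) * c f′) + t * c f ≤⟨ middle-layer f′ e₀ t (c f′) (c f) (c (suc f)) (subst (1 ≤_) (sym v₂≡) 1≤v₂) eq₂ eq₁ ⟩
      d * c (suc f)                      ∎)
      where
      shape : ∀ d y b t → d * (y + b * t) ≡ d * y + t * (b * d)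
      shape = solve-∀
      v₂≡ : e₀ + t ≡ v₂
      v₂≡ = m+[n∸m]≡n (s≤s⁻¹ (s≤s⁻¹ d≤v))
      l = f * (1 + e₀) + suc f * t
      expand : ∀ g e t → suc (suc g) * (2 + (e + t)) ≡ suc g + (suc g * (1 + e) + suc (suc g) * t) + (2 + e)
      expand = solve-∀
      N≡ : N ≡ f + l
      N≡ = +-cancelʳ-≡ d N _ (trans N+d (trans (cong (λ z → suc f * (2 + z)) (sym v₂≡)) (expand f′ e₀ t)))
      eq₂ : suc f * c (suc f) ≡ l * c f
      eq₂ = +-cancelʳ-≡ (f * c f) _ _ (trans (absorb f) (trans (cong (_* c f) (trans N≡ (+-comm f l))) (*-distribʳ-+ (c f) l f)))
      eq₁ : f * c f ≡ suc l * c f′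
      eq₁ = +-cancelʳ-≡ (f′ * c f′) _ _ (trans (absorb f′) (trans (cong (_* c f′) (trans N≡ (trans (+-comm f l) (+-suc l f′)))) (*-distribʳ-+ (c f′) (suc l) f′)))

    layer₂ : v₂ ≡ 0 → Y f + B * t ≤ c (suc f)
    layer₂ refl = begin
      Y f + B * t ≡⟨ cong (λ z → Y f + B * z) (m≤n⇒m∸n≡0 2≤d) ⟩
      Y f + B * 0 ≡⟨ trans (cong (Y f +_) (*-zeroʳ B)) (+-identityʳ (Y f)) ⟩
      Y f         ≤⟨ Y-binary refl f ≤-refl e≤v₂ ⟩
      c (suc f)   ∎

    no-extras : ∀ {i j} → i ≡ 0 → j ≡ 0 → B * (d * i + t * j) ≡ 0
    no-extras refl refl = trans (cong (B *_) (cong₂ _+_ (*-zeroʳ d) (*-zeroʳ t))) (*-zeroʳ B)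

    bound : ∀ s → Region f s → occs s list ≤ c s
    bound s (below s<f) = begin
      occs s list            ≡⟨ occs-list s ⟩
      occs s (groups f) + B * (d * 𝟙 (f ≟ s) + t * 𝟙 (suc f ≟ s)) ≡⟨ cong (occs s (groups f) +_) (no-extras (𝟙-no (f ≟ s) (λ q → <-irrefl (sym q) s<f)) (𝟙-no (suc f ≟ s) (λ q → <-irrefl (sym q) (m≤n⇒m≤1+n s<f)))) ⟩
      occs s (groups f) + 0  ≡⟨ +-identityʳ _ ⟩
      occs s (groups f)      ≤⟨ groups-small f s<f ⟩
      c s                    ∎
    bound _ middle = begin
      occs f list            ≡⟨ occs-list f ⟩
      occs f (groups f) + B * (d * 𝟙 (f ≟ f) + t * 𝟙 (suc f ≟ f)) ≡⟨ cong₂ _+_ (groups-f f ≤-refl) (only (𝟙-yes (f ≟ f) refl) (𝟙-no (suc f ≟ f) 1+n≢n)) ⟩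
      P + B * d              ≤⟨ +-monoʳ-≤ P Bd≤ ⟩
      P + (c f ∸ P)          ≡⟨ m+[n∸m]≡n P≤ ⟩
      c f                    ∎
      where
      only : ∀ {i j} → i ≡ 1 → j ≡ 0 → B * (d * i + t * j) ≡ B * d
      only refl refl = cong (B *_) (trans (cong₂ _+_ (*-identityʳ d) (*-zeroʳ t)) (+-identityʳ d))
    bound _ next = begin
      occs (suc f) list      ≡⟨ occs-list (suc f) ⟩
      occs (suc f) (groups f) + B * (d * 𝟙 (f ≟ suc f) + t * 𝟙 (suc f ≟ suc f)) ≡⟨ cong₂ _+_ (groups-1+f f ≤-refl) (only (𝟙-no (f ≟ suc f) (1+n≢n ∘ sym)) (𝟙-yes (suc f ≟ suc f) refl)) ⟩
      Y f + B * t            ≤⟨ [ layer₂ , layer ]′ (n≡0⊎n>0 v₂) ⟩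
      c (suc f)              ∎
      where
      only : ∀ {i j} → i ≡ 0 → j ≡ 1 → B * (d * i + t * j) ≡ B * t
      only refl refl = cong (B *_) (cong₂ _+_ (*-zeroʳ d) (*-identityʳ t))
    bound s (above k) = begin
      occs s list            ≡⟨ occs-list s ⟩
      occs s (groups f) + B * (d * 𝟙 (f ≟ s) + t * 𝟙 (suc f ≟ s)) ≡⟨ cong (occs s (groups f) +_) (no-extras (𝟙-no (f ≟ s) (λ q → <-irrefl q (<⇒≤ 1+f<s))) (𝟙-no (suc f ≟ s) (λ q → <-irrefl q 1+f<s))) ⟩
      occs s (groups f) + 0  ≡⟨ +-identityʳ _ ⟩
      occs s (groups f)      ≤⟨ groups-large f k ≤-refl ⟩
      c s                    ∎
      where
      1+f<s : suc f < suc f + suc k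
      1+f<s = m<m+n (suc f) (s≤s z≤n)

    shapes : Shapes N (2 + v₂) c (weights / d)
    shapes = record { list = list
                    ; shape = AllP.++⁺ (groups-shape f ≤-refl e≤v₂) (AllP.replicate⁺ B rest-shape)
                    ; amount = amount ; occs≤c = λ s → bound s (region f s) }

  module Extremal (d≡1+v : d ≡ 3 + v₂) where

    P R B : ℕ
    P = ∑< f′ (λ i → c i * e i)
    -- The groups stop before size f - 1, whose column would need d - 2 = v - 1 sets of size f where
    -- only v - 2 fit. What is left weighs 1 per set of size f and 2 per set of size f - 1.
    R = (c f ∸ P) + 2 * c f′
    B = R / d

    e≤v₂ : ∀ i → i < f′ → e i ≤ v₂
    e≤v₂ i i<f′ = ≤-trans (∸-monoʳ-≤ d (m+n≤o⇒m≤o∸n 3 (s≤s (s≤s i<f′)))) (≤-reflexive (cong (_∸ 3) d≡1+v))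

    P≤ : P ≤ c f′
    P≤ = e-sum f′ (n≤1+n f′) e≤v₂

    1+N : suc N ≡ f * (2 + v₂)
    1+N = +-cancelʳ-≡ (2 + v₂) _ _ (begin-equality
      suc N + (2 + v₂)     ≡⟨ +-suc N (2 + v₂) ⟨
      N + (3 + v₂)         ≡⟨ cong (N +_) d≡1+v ⟨
      N + d                ≡⟨ N+d ⟩
      suc f * (2 + v₂)     ≡⟨ +-comm (2 + v₂) _ ⟩
      f * (2 + v₂) + (2 + v₂) ∎)

    -- For d = v + 1 one has N + 1 = f v, so the bound `c-ratio` is attained at f - 1.
    c-f : c f ≡ suc v₂ * c f′
    c-f = *-cancelˡ-≡ _ _ f (+-cancelʳ-≡ (f′ * c f′) _ _ (begin-equality
      f * c f + f′ * c f′                ≡⟨ absorb f′ ⟩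
      N * c f′                           ≡⟨ cong (_* c f′) (suc-injective (trans 1+N (expand f′ v₂))) ⟩
      (f * suc v₂ + f′) * c f′           ≡⟨ shape f f′ (suc v₂) (c f′) ⟩
      f * (suc v₂ * c f′) + f′ * c f′    ∎))
      where
      expand : ∀ g v → suc g * (2 + v) ≡ suc (suc g * suc v + g)
      expand = solve-∀
      shape : ∀ f g v z → (f * v + g) * z ≡ f * (v * z) + g * z
      shape = solve-∀

    P≤c-f : P ≤ c f
    P≤c-f = ≤-trans P≤ (subst (c f′ ≤_) (sym c-f) (m≤m+n (c f′) _))

    abstract
      split : ∃[ p ] ∃[ q ] (p + q ≡ B × p + (q + q) ≤ c f′ × q + q ≤ c f′ × P + (p * suc v₂ + q * (v₂ ∸ 1)) ≤ c f × (q ≡ 0 ⊎ 1 ≤ v₂))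
      split = split-pairs v₂ (c f) (c f′) P c-f P≤
        (λ v₂≡0 → ∑<-zero f′ λ i i<f′ → trans (cong (c i *_) (n≤0⇒n≡0 (subst (e i ≤_) v₂≡0 (e≤v₂ i i<f′)))) (*-zeroʳ (c i)))
        B (subst (λ z → B * z ≤ R) d≡1+v (m/n*n≤m R d))

    p q : ℕ
    p = proj₁ split
    q = proj₁ (proj₂ split)

    p+q≡B : p + q ≡ B
    p+q≡B = proj₁ (proj₂ (proj₂ split))

    p+2q≤ : p + (q + q) ≤ c f′
    p+2q≤ = proj₁ (proj₂ (proj₂ (proj₂ split)))

    2q≤ : q + q ≤ c f′
    2q≤ = proj₁ (proj₂ (proj₂ (proj₂ (proj₂ split))))

    ones≤ : P + (p * suc v₂ + q * (v₂ ∸ 1)) ≤ c f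
    ones≤ = proj₁ (proj₂ (proj₂ (proj₂ (proj₂ (proj₂ split)))))

    q≡0⊎3≤v : q ≡ 0 ⊎ 1 ≤ v₂
    q≡0⊎3≤v = proj₂ (proj₂ (proj₂ (proj₂ (proj₂ (proj₂ split)))))

    -- Both weigh d: 2 + (v - 1) and 4 + (v - 3). In `two` a set of size f + 1, of weight 0, keeps
    -- the sum of the sizes at N.
    one two : List ℕ
    one = f′ ∷ replicate (suc v₂) f
    two = f′ ∷ f′ ∷ suc f ∷ replicate (v₂ ∸ 1) f

    one-shape : Shape N (2 + v₂) one
    one-shape = cong suc (length-replicate (suc v₂)) , suc-injective (begin-equality
      suc (f′ + List.sum (replicate (suc v₂) f)) ≡⟨ cong (λ z → suc (f′ + z)) (sum-replicate (suc v₂) f) ⟩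
      f + suc v₂ * f                             ≡⟨ *-comm (2 + v₂) f ⟩
      f * (2 + v₂)                               ≡⟨ 1+N ⟨
      suc N                                      ∎)

    two-shape : 1 ≤ v₂ → Shape N (2 + v₂) two
    two-shape 1≤v₂ = trans (cong (3 +_) (length-replicate (v₂ ∸ 1))) (cong (2 +_) (m+[n∸m]≡n 1≤v₂)) , suc-injective (begin-equality
      suc (f′ + (f′ + (suc f + List.sum (replicate (v₂ ∸ 1) f)))) ≡⟨ cong (λ z → suc (f′ + (f′ + (suc f + z)))) (sum-replicate (v₂ ∸ 1) f) ⟩
      suc (f′ + (f′ + (suc f + (v₂ ∸ 1) * f)))                    ≡⟨ shape f′ (v₂ ∸ 1) ⟩
      f * (2 + (1 + (v₂ ∸ 1)))                                    ≡⟨ cong (λ z → f * (2 + z)) (m+[n∸m]≡n 1≤v₂) ⟩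
      f * (2 + v₂)                                                ≡⟨ 1+N ⟨
      suc N                                                       ∎)
      where
      shape : ∀ g w → suc (g + (g + (suc (suc g) + w * suc g))) ≡ suc g * (2 + (1 + w))
      shape = solve-∀

    occ-one : ∀ s → occ s one ≡ 𝟙 (f′ ≟ s) + suc v₂ * 𝟙 (f ≟ s)
    occ-one s = cong (𝟙 (f′ ≟ s) +_) (occ-replicate s (suc v₂) f)

    occ-two : ∀ s → occ s two ≡ 𝟙 (f′ ≟ s) + (𝟙 (f′ ≟ s) + (𝟙 (suc f ≟ s) + (v₂ ∸ 1) * 𝟙 (f ≟ s)))
    occ-two s = cong (λ z → 𝟙 (f′ ≟ s) + (𝟙 (f′ ≟ s) + (𝟙 (suc f ≟ s) + z))) (occ-replicate s (v₂ ∸ 1) f)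

    list : List (List ℕ)
    list = groups f′ ++ replicate p one ++ replicate q two

    extras : ℕ → ℕ → ℕ → ℕ
    extras i j k = p * (i + suc v₂ * j) + q * (i + (i + (k + (v₂ ∸ 1) * j)))

    occs-list : ∀ s {i j k} → 𝟙 (f′ ≟ s) ≡ i → 𝟙 (f ≟ s) ≡ j → 𝟙 (suc f ≟ s) ≡ k → occs s list ≡ occs s (groups f′) + extras i j k
    occs-list s refl refl refl = trans (occs-++ s (groups f′) _) (cong (occs s (groups f′) +_)
      (trans (occs-++ s (replicate p one) _) (cong₂ _+_ (trans (occs-replicate s p one) (cong (p *_) (occ-one s)))
                                                       (trans (occs-replicate s q two) (cong (q *_) (occ-two s))))))

    amount : length list ≡ weights / d
    amount = begin-equality
      length list                    ≡⟨ trans (length-++ (groups f′)) (cong₂ _+_ (groups-length f′) (trans (length-++ (replicate p one)) (cong₂ _+_ (length-replicate p) (length-replicate q)))) ⟩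
      ∑< f′ c + (p + q)              ≡⟨ cong (∑< f′ c +_) p+q≡B ⟩
      ∑< f′ c + R / d                ≡⟨ [q*d+r]/d (∑< f′ c) R d ⟨
      (∑< f′ c * d + R) / d          ≡⟨ cong (_/ d) (+-cancelʳ-≡ P _ _ balance) ⟨
      weights / d                    ∎
      where
      W = ∑< f′ (λ i → c i * weight f d i)
      shuffle : ∀ w x z p → w + z * 2 + x + p ≡ w + p + (x + 2 * z)
      shuffle = solve-∀
      shuffle₂ : ∀ s r t p → s + (r + p + t) ≡ s + (r + t) + p
      shuffle₂ = solve-∀
      balance : weights + P ≡ ∑< f′ c * d + R + P
      balance = begin-equality
        weights + P
          ≡⟨ cong (_+ P) (trans (∑<-suc f (λ i → c i * weight f d i)) (cong (_+ c f * weight f d f) (∑<-suc f′ (λ i → c i * weight f d i)))) ⟩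
        W + c f′ * (d ⊓ a f′) + c f * (d ⊓ a f) + P
          ≡⟨ cong₂ (λ i j → W + c f′ * i + j + P) (trans (cong (d ⊓_) a-f′) (m≥n⇒m⊓n≡n 2≤d)) (trans (cong (c f *_) (trans (cong (d ⊓_) a-f) d⊓1≡1)) (*-identityʳ (c f))) ⟩
        W + c f′ * 2 + c f + P            ≡⟨ shuffle W (c f) (c f′) P ⟩
        W + P + (c f + 2 * c f′)          ≡⟨ cong₂ (λ i j → i + (j + 2 * c f′)) (weights-split f′) (sym (m∸n+n≡m P≤c-f)) ⟩
        ∑< f′ c * d + (c f ∸ P + P + 2 * c f′) ≡⟨ shuffle₂ (∑< f′ c * d) (c f ∸ P) (2 * c f′) P ⟩
        ∑< f′ c * d + R + P               ∎

    -- Each `two` uses one set of size f + 1. For v ≥ 3 the demand is at most 2 `c f′`, hence at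
    -- most `c f`; passing to `c (suc f)` requires 2 f + 1 ≤ N, which can fail for f = 1, so that
    -- case compares `c 0` with `c 2` instead.
    Y+q : Y f′ + q ≤ c (suc f)
    Y+q = [ small , (λ 1≤v₂ → large 1≤v₂ f′ refl) ]′ (n≡0⊎n>0 v₂)
      where
      room : ∀ g v → f′ ≡ suc g → v₂ ≡ suc v → f + suc f ≤ N
      room g v refl refl = s≤s⁻¹ (≤-trans (m≤m+n _ (g + v * suc (suc g))) (≤-reflexive (trans (shape g v) (sym 1+N))))
        where
        shape : ∀ g v → suc (suc (suc g) + suc (suc (suc g))) + (g + v * suc (suc g)) ≡ suc (suc g) * (2 + suc v)
        shape = solve-∀
      large : 1 ≤ v₂ → ∀ g → f′ ≡ g → Y f′ + q ≤ c (suc f)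
      large 1≤v₂ zero refl = ≤-trans (≤-trans (m≤m+n q q) 2q≤) (c-mono z≤n (s≤s⁻¹ (begin
        3                ≤⟨ +-monoʳ-≤ 2 1≤v₂ ⟩
        2 + v₂           ≡⟨ *-identityˡ (2 + v₂) ⟨
        1 * (2 + v₂)     ≡⟨ 1+N ⟨
        suc N            ∎)))
      large 1≤v₂ (suc g) refl = *-cancelˡ-≤ 2 (begin
        2 * (Y f′ + q)                ≡⟨ shape₀ (Y f′) q ⟩
        2 * Y f′ + (q + q)            ≤⟨ +-mono-≤ 2Y≤ 2q≤ ⟩
        3 * c f′ + c f′               ≡⟨ shape₁ (c f′) ⟩
        2 * (2 * c f′)                ≤⟨ *-monoʳ-≤ 2 (*-monoˡ-≤ (c f′) (s≤s 1≤v₂)) ⟩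
        2 * (suc v₂ * c f′)           ≡⟨ cong (2 *_) c-f ⟨
        2 * c f                       ≤⟨ *-monoʳ-≤ 2 (c-mono (n≤1+n f) (room g (v₂ ∸ 1) refl (sym (m+[n∸m]≡n 1≤v₂)))) ⟩
        2 * c (suc f)                 ∎)
        where
        shape₀ : ∀ y q → 2 * (y + q) ≡ 2 * y + (q + q)
        shape₀ = solve-∀
        shape₁ : ∀ z → 3 * z + z ≡ 2 * (2 * z)
        shape₁ = solve-∀
        shape₂ : ∀ z → 2 * (2 * z + z * 1) ≡ 3 * (2 * z)
        shape₂ = solve-∀
        a-g : a g ≡ 3
        a-g = m+n∸n≡m 3 g
        y-g : y g ≤ 1
        y-g = ≤-trans (+-monoʳ-≤ (𝟙 (x g ≟ 0)) (≤-reflexive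
          (trans (cong (v₂ ∸_) (trans (cong (d ∸_) a-g) (cong (_∸ 3) d≡1+v))) (n∸n≡0 v₂)))) (≤-trans (≤-reflexive (+-identityʳ _)) (𝟙≤1 (x g ≟ 0)))
        2Y≤ : 2 * Y f′ ≤ 3 * c f′
        2Y≤ = begin
          2 * Y f′                      ≡⟨ cong (2 *_) (Y-suc g) ⟩
          2 * (Y g + c g * y g)         ≤⟨ *-monoʳ-≤ 2 (+-mono-≤ (Y≤2 1≤v₂ g (≤-trans (n≤1+n g) (n≤1+n f′))) (*-monoʳ-≤ (c g) y-g)) ⟩
          2 * (2 * c g + c g * 1)       ≡⟨ shape₂ (c g) ⟩
          3 * (2 * c g)                 ≤⟨ *-monoʳ-≤ 3 (*-monoˡ-≤ (c g) (s≤s 1≤v₂)) ⟩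
          3 * (suc v₂ * c g)            ≤⟨ *-monoʳ-≤ 3 (c-ratio g (s≤s (n≤1+n g))) ⟩
          3 * c f′                      ∎
      small : v₂ ≡ 0 → Y f′ + q ≤ c (suc f)
      small v₂≡0 = ≤-trans (≤-reflexive (trans (cong (Y f′ +_) q≡0) (+-identityʳ _))) (Y-binary v₂≡0 f′ (n≤1+n f′) e≤v₂)
        where
        q≡0 : q ≡ 0
        q≡0 = [ id , (λ 1≤v₂ → ⊥-elim (<-irrefl (sym v₂≡0) 1≤v₂)) ]′ q≡0⊎3≤v

    no-extras : extras 0 0 0 ≡ 0
    no-extras = shape p q (suc v₂) (v₂ ∸ 1)
      where
      shape : ∀ p q v w → p * (0 + v * 0) + q * (0 + (0 + (0 + w * 0))) ≡ 0
      shape = solve-∀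

    bound-below : ∀ s → s < f → s < f′ ⊎ s ≡ f′ → occs s list ≤ c s
    bound-below s s<f (inj₁ s<f′) = begin
      occs s list                            ≡⟨ occs-list s (𝟙-no (f′ ≟ s) (λ z → <-irrefl (sym z) s<f′)) (𝟙-no (f ≟ s) (λ z → <-irrefl (sym z) s<f)) (𝟙-no (suc f ≟ s) (λ z → <-irrefl (sym z) (m≤n⇒m≤1+n s<f))) ⟩
      occs s (groups f′) + extras 0 0 0      ≡⟨ cong (occs s (groups f′) +_) no-extras ⟩
      occs s (groups f′) + 0                 ≡⟨ +-identityʳ _ ⟩
      occs s (groups f′)                     ≤⟨ groups-small f′ s<f ⟩
      c s                                    ∎
    bound-below _ _ (inj₂ refl) = begin
      occs f′ list                           ≡⟨ occs-list f′ (𝟙-yes (f′ ≟ f′) refl) (𝟙-no (f ≟ f′) 1+n≢n) (𝟙-no (suc f ≟ f′) (λ z → <-irrefl (sym z) (s≤s (n≤1+n f′)))) ⟩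
      occs f′ (groups f′) + extras 1 0 0     ≡⟨ cong₂ _+_ (groups-absent f′ ≤-refl ≤-refl) (shape p q (suc v₂) (v₂ ∸ 1)) ⟩
      p + (q + q)                            ≤⟨ p+2q≤ ⟩
      c f′                                   ∎
      where
      shape : ∀ p q v w → p * (1 + v * 0) + q * (1 + (1 + (0 + w * 0))) ≡ p + (q + q)
      shape = solve-∀

    bound : ∀ s → Region f s → occs s list ≤ c s
    bound s (below s<f) = bound-below s s<f (m≤n⇒m<n∨m≡n (s≤s⁻¹ s<f))
    bound _ middle = begin
      occs f list                            ≡⟨ occs-list f (𝟙-no (f′ ≟ f) (1+n≢n ∘ sym)) (𝟙-yes (f ≟ f) refl) (𝟙-no (suc f ≟ f) 1+n≢n) ⟩
      occs f (groups f′) + extras 0 1 0      ≡⟨ cong₂ _+_ (groups-f f′ (n≤1+n f′)) (cong₂ (λ i j → p * i + q * j) (*-identityʳ (suc v₂)) (*-identityʳ (v₂ ∸ 1))) ⟩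
      P + (p * suc v₂ + q * (v₂ ∸ 1))        ≤⟨ ones≤ ⟩
      c f                                    ∎
    bound _ next = begin
      occs (suc f) list                      ≡⟨ occs-list (suc f) (𝟙-no (f′ ≟ suc f) (λ z → <-irrefl z (s≤s (n≤1+n f′)))) (𝟙-no (f ≟ suc f) (1+n≢n ∘ sym)) (𝟙-yes (suc f ≟ suc f) refl) ⟩
      occs (suc f) (groups f′) + extras 0 0 1 ≡⟨ cong₂ _+_ (groups-1+f f′ (n≤1+n f′)) (shape p q (suc v₂) (v₂ ∸ 1)) ⟩
      Y f′ + q                               ≤⟨ Y+q ⟩
      c (suc f)                              ∎
      where
      shape : ∀ p q v w → p * (0 + v * 0) + q * (0 + (0 + (1 + w * 0))) ≡ q
      shape = solve-∀
    bound s (above k) = begin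
      occs s list                            ≡⟨ occs-list s (𝟙-no (f′ ≟ s) (λ z → <-irrefl z (<⇒≤ (<⇒≤ 1+f<s)))) (𝟙-no (f ≟ s) (λ z → <-irrefl z (<⇒≤ 1+f<s))) (𝟙-no (suc f ≟ s) (λ z → <-irrefl z 1+f<s)) ⟩
      occs s (groups f′) + extras 0 0 0      ≡⟨ cong (occs s (groups f′) +_) no-extras ⟩
      occs s (groups f′) + 0                 ≡⟨ +-identityʳ _ ⟩
      occs s (groups f′)                     ≤⟨ groups-large f′ k (n≤1+n f′) ⟩
      c s                                    ∎
      where
      1+f<s : suc f < suc f + suc k
      1+f<s = m<m+n (suc f) (s≤s z≤n)

    shapes : Shapes N (2 + v₂) c (weights / d)
    shapes = record { list = list
                    ; shape = AllP.++⁺ (groups-shape f′ (n≤1+n f′) e≤v₂) (AllP.++⁺ (AllP.replicate⁺ p one-shape) (twos q≡0⊎3≤v))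
                    ; amount = amount ; occs≤c = λ s → bound s (region f s) }
      where
      twos : q ≡ 0 ⊎ 1 ≤ v₂ → All (Shape N (2 + v₂)) (replicate q two)
      twos (inj₁ q≡0) = subst (λ n → All (Shape N (2 + v₂)) (replicate n two)) (sym q≡0) []
      twos (inj₂ 1≤v₂) = AllP.replicate⁺ q (two-shape 1≤v₂)

-- Binomial coefficients as layer sizes, and the conclusion.

binomial-absorb : ∀ N i → suc i * (N C suc i) + i * (N C i) ≡ N * (N C i)
binomial-absorb zero zero = refl
binomial-absorb zero (suc i) = cong₂ _+_ (trans (cong (suc (suc i) *_) (k>n⇒nCk≡0 {0} {suc (suc i)} (s≤s z≤n))) (*-zeroʳ (suc (suc i))))
                                         (trans (cong (suc i *_) (k>n⇒nCk≡0 {0} {suc i} (s≤s z≤n))) (*-zeroʳ (suc i)))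
binomial-absorb (suc m) zero = trans (+-identityʳ _) (absorption m 0)
binomial-absorb (suc m) (suc i) = begin
  suc (suc i) * (suc m C suc (suc i)) + suc i * (suc m C suc i) ≡⟨ cong₂ _+_ (absorption m (suc i)) (absorption m i) ⟩
  suc m * (m C suc i) + suc m * (m C i)                         ≡⟨ *-distribˡ-+ (suc m) (m C suc i) (m C i) ⟨
  suc m * (m C suc i + m C i)                                   ≡⟨ cong (suc m *_) (trans (+-comm (m C suc i) _) (sym (pascal m i))) ⟩
  suc m * (suc m C suc i)                                       ∎
  where open ≡-Reasoning

binomial-mono : ∀ N {i s} → i ≤ s → i + s ≤ N → N C i ≤ N C s
binomial-mono N {s = zero} z≤n _ = ≤-refl
binomial-mono (suc N) {zero} {suc s} _ (s≤s s≤N) = begin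
  N C 0                ≤⟨ binomial-mono N z≤n s≤N ⟩
  N C s                ≤⟨ m≤m+n (N C s) (N C suc s) ⟩
  N C s + N C suc s    ≡⟨ pascal N s ⟨
  suc N C suc s        ∎
  where open ≤-Reasoning
binomial-mono (suc N) {suc i} {suc s} (s≤s i≤s) (s≤s room) with m≤n⇒m<n∨m≡n i≤s
... | inj₂ refl = ≤-refl
... | inj₁ i<s = begin
  suc N C suc i        ≡⟨ pascal N i ⟩
  N C i + N C suc i    ≤⟨ +-mono-≤ (binomial-mono N (m≤n⇒m≤1+n i≤s) room) (binomial-mono N i<s (≤-trans (≤-reflexive (sym (+-suc i s))) room)) ⟩
  N C suc s + N C s    ≡⟨ +-comm (N C suc s) (N C s) ⟩
  N C s + N C suc s    ≡⟨ pascal N s ⟨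
  suc N C suc s        ∎
  where open ≤-Reasoning

ΛAt-div′ : ∀ N f {d} → 2 ≤ d → ΛAt N f d (pos d) ≡ weightSum N f d div′ d
ΛAt-div′ N f {suc (suc e)} (s≤s (s≤s z≤n)) = ΛAt-weightSum N f e

shapes-exist : ∀ N v₂ f′ d → N + d ≡ suc (suc f′) * (2 + v₂) → 2 ≤ d → suc f′ * (2 + v₂) ≤ suc N →
  Shapes N (2 + v₂) (N C_) (weightSum N (suc f′) d div′ d)
shapes-exist N v₂ f′ (suc d) N+d 2≤d fv≤1+N = [ ordinary , extremal ]′ (m≤n⇒m<n∨m≡n d≤1+v)
  where
  open Construction N v₂ f′ (suc d) (N C_) N+d 2≤d (binomial-absorb N) (binomial-mono N) fv≤1+N
  d≤1+v : suc d ≤ 3 + v₂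
  d≤1+v = +-cancelˡ-≤ N _ _ (begin
    N + suc d                             ≡⟨ N+d ⟩
    (2 + v₂) + suc f′ * (2 + v₂)          ≤⟨ +-monoʳ-≤ (2 + v₂) fv≤1+N ⟩
    (2 + v₂) + suc N                      ≡⟨ +-comm (2 + v₂) (suc N) ⟩
    suc N + (2 + v₂)                      ≡⟨ +-suc N (2 + v₂) ⟨
    N + (3 + v₂)                          ∎)
    where open ≤-Reasoning
  ordinary : suc d < 3 + v₂ → Shapes N (2 + v₂) (N C_) (weightSum N (suc f′) (suc d) / suc d)
  ordinary d<1+v = Ordinary.shapes (s≤s⁻¹ d<1+v)
  extremal : suc d ≡ 3 + v₂ → Shapes N (2 + v₂) (N C_) (weightSum N (suc f′) (suc d) / suc d)
  extremal d≡1+v = Extremal.shapes d≡1+v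

≤-div′ : ∀ k {n d} → 2 ≤ d → k * d ≤ n → k ≤ n div′ d
≤-div′ k {n} {suc d} _ kd≤n = subst (_≤ n / suc d) (m*n/n≡m k (suc d)) (/-monoˡ-≤ (suc d) kd≤n)

theorem1p2 : (N v : ℕ) → 2 ≤ v → v ≤ N + 1 → IsLAK11 N v (Λ N v)
theorem1p2 N v@(suc (suc v₂)) 2≤v@(s≤s (s≤s z≤n)) v≤N+1 = subst (IsLAK11 N v) (sym Λ≡) lak
  where
  f d : ℕ
  f = (N + 1) / v
  d = (f + 1) * v ∸ N

  N+2≤ : 2 + N ≤ (f + 1) * v
  N+2≤ = begin
    suc (suc N)                  ≡⟨ cong suc (+-comm 1 N) ⟩
    suc (N + 1)                  ≡⟨ cong suc (m≡m%n+[m/n]*n (N + 1) v) ⟩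
    suc ((N + 1) % v) + f * v    ≤⟨ +-monoˡ-≤ (f * v) (m%n<n (N + 1) v) ⟩
    v + f * v                    ≡⟨ cong (_* v) (+-comm 1 f) ⟩
    (f + 1) * v                  ∎
    where open ≤-Reasoning

  N≤ : N ≤ (f + 1) * v
  N≤ = ≤-trans (m≤n+m N 2) N+2≤

  2≤d : 2 ≤ d
  2≤d = m+n≤o⇒m≤o∸n 2 N+2≤

  N+d : N + d ≡ suc f * v
  N+d = trans (m+[n∸m]≡n N≤) (cong (_* v) (+-comm f 1))

  fv≤1+N : f * v ≤ suc N
  fv≤1+N = ≤-trans (m/n*n≤m (N + 1) v) (≤-reflexive (+-comm N 1))

  dz≡ : pos (f + 1) ℤ.* pos v ℤ.- pos N ≡ pos d
  dz≡ = trans (cong (ℤ._- pos N) (sym (ℤP.pos-* (f + 1) v))) (trans (ℤP.m-n≡m⊖n ((f + 1) * v) N) (ℤP.⊖-≥ N≤))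

  Λ≡ : Λ N v ≡ weightSum N f d div′ d
  Λ≡ = trans (cong (ΛAt N f d) dz≡) (ΛAt-div′ N f 2≤d)

  existence : ∀ f → 0 < f → N + d ≡ suc f * v → f * v ≤ suc N → ∃[ A ] Is11LA {N} {weightSum N f d div′ d} {v} A
  existence (suc f′) _ N+d fv≤1+N = shapes⇒array (shapes-exist N v₂ f′ d N+d 2≤d fv≤1+N)

  lak : IsLAK11 N v (weightSum N f d div′ d)
  lak = existence f (m≥n⇒m/n>0 v≤N+1) N+d fv≤1+N , λ k A la → ≤-div′ k 2≤d (upper-bound N+d A la)
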